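{- Let $k$ be a positive integer and let $n\geq 34k^3$. If $G$ is a connected graph with $n$ vertices and at most $n\left(1+\frac{1}{119k^2+62k}\right)$ edges, then $r(G,B_k)=2n-1$.
   Context: For graphs $G,H$, the Ramsey number $r(G,H)$ is the smallest positive integer $N$ such that every red-blue coloring of the edges of the complete graph $K_N$ contains a red subgraph isomorphic to $G$ or a blue subgraph isomorphic to $H$. The book $B_k$ is the graph $K_2+\overline{K}_k$ on $k+2$ vertices, i.e. an edge together with $k$ further vertices each adjacent to both endpoints of that edge (equivalently $k$ triangles sharing a common edge). All graphs are finite and simple. -}

module Defs where

open import Data.Nat using (ℕ; zero; suc; _+_; _*_; _<ᵇ_; _≤_; _<_)
open import Data.Bool using (Bool; true; false; _∧_; if_then_else_)
open import Data.Fin using (Fin; toℕ) renaming (zero to fz; suc to fs)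
open import Data.List using (List; map; allFin)
open import Data.Nat.ListAction using (sum)
open import Data.Product using (Σ; _×_; _,_)
open import Data.Sum using (_⊎_)
open import Relation.Binary.PropositionalEquality using (_≡_; refl)
open import Relation.Nullary using (¬_)
open import Function.Definitions using (Injective)

record Graph (n : ℕ) : Set where
  field
    Adj   : Fin n → Fin n → Bool
    sym   : ∀ i j → Adj i j ≡ Adj j i
    irrefl : ∀ i → Adj i i ≡ false
open Graph public

edgeCount : ∀ {n} → Graph n → ℕ
edgeCount {n} G =
  sum (map (λ i → sum (map (λ j → if (toℕ i <ᵇ toℕ j) ∧ Adj G i j then 1 else 0)
                             (allFin n)))
           (allFin n))

data Walk {n : ℕ} (G : Graph n) : Fin n → Fin n → Set where
  here : ∀ {u} → Walk G u u
  step : ∀ {u v w} → Adj G u v ≡ true → Walk G v w → Walk G u w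

Connected : ∀ {n} → Graph n → Set
Connected G = ∀ u v → Walk G u v

-- the book B_k = K_2 + complement(K_k) on vertex set Fin (k+2):
-- vertices 0 and 1 form the spine, every other vertex is adjacent to both.
bookAdj : ∀ k → Fin (suc (suc k)) → Fin (suc (suc k)) → Bool
bookAdj k fz fz = false
bookAdj k fz (fs _) = true
bookAdj k (fs fz) fz = true
bookAdj k (fs fz) (fs fz) = false
bookAdj k (fs fz) (fs (fs _)) = true
bookAdj k (fs (fs _)) fz = true
bookAdj k (fs (fs _)) (fs fz) = true
bookAdj k (fs (fs _)) (fs (fs _)) = false

bookSym : ∀ k i j → bookAdj k i j ≡ bookAdj k j i
bookSym k fz fz = refl
bookSym k fz (fs fz) = refl
bookSym k fz (fs (fs _)) = refl
bookSym k (fs fz) fz = refl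
bookSym k (fs fz) (fs fz) = refl
bookSym k (fs fz) (fs (fs _)) = refl
bookSym k (fs (fs _)) fz = refl
bookSym k (fs (fs _)) (fs fz) = refl
bookSym k (fs (fs _)) (fs (fs _)) = refl

bookIrr : ∀ k i → bookAdj k i i ≡ false
bookIrr k fz = refl
bookIrr k (fs fz) = refl
bookIrr k (fs (fs _)) = refl

Book : (k : ℕ) → Graph (suc (suc k))
Book k = record { Adj = bookAdj k ; sym = bookSym k ; irrefl = bookIrr k }

data Colour : Set where
  red blue : Colour

-- a red/blue colouring of the edges of K_N (symmetric; diagonal values irrelevant)
record Colouring (N : ℕ) : Set where
  field
    col    : Fin N → Fin N → Colour
    colSym : ∀ x y → col x y ≡ col y x
open Colouring public

ContainsMono : ∀ {N m} → Colouring N → Colour → Graph m → Set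
ContainsMono {N} {m} χ c H =
  Σ (Fin m → Fin N) λ f → Injective _≡_ _≡_ f ×
    (∀ i j → Adj H i j ≡ true → col χ (f i) (f j) ≡ c)

Arrows : ∀ {n m} → ℕ → Graph n → Graph m → Set
Arrows N G H = (χ : Colouring N) → ContainsMono χ red G ⊎ ContainsMono χ blue H

RamseyNumberIs : ∀ {n m} → Graph n → Graph m → ℕ → Set
RamseyNumberIs G H N =
  1 ≤ N × Arrows N G H × (∀ M → 1 ≤ M → M < N → ¬ Arrows M G H)

module Submission where

-- Let N = 2n - 1, fix a colouring without blue B_k, and embed G into the red graph by induction on the number of
-- vertices, for graphs that stay connected and locally sparse.  G contains a long suspended path, many leaves, or few
-- vertices, because the vertices of degree other than 2 have few edges, and every other vertex is on a path of vertices
-- of degree 2 that starts with one of these edges.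
--   * A suspended path with 3k + 2 vertices is shortened by one vertex.  If the red copy of the shorter graph cannot be
--     lengthened again, then the successors (along the path) of the red neighbours of an unused vertex w form, with w, a
--     blue clique; so w has at most k red neighbours there, any two unused vertices have k common blue neighbours on the
--     path, and the at least n unused vertices form a red clique.
--   * If all blue degrees are below n, a deleted leaf can always be put back, and a graph with few vertices is embedded
--     greedily, starting inside the largest blue neighbourhood, where every vertex has blue degree less than k.
--   * If n vertices W lie in one blue neighbourhood, graphs with at most n - 2(k - 1) vertices are embedded greedily into W.
--     For larger ones, let Z be the vertices of W with many red neighbours outside W; the others form a red clique.
--     If Z is large, it receives the parents of 2(k - 1) leaves, which are then placed outside W; if Z is small, it is
--     filled with leaves.

open import Defs
open import Data.Nat using (ℕ; suc; _+_; _*_; _∸_; _^_; _≤_)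
open import Data.Nat using (zero; _<_; z≤n; s≤s; s≤s⁻¹; _≡ᵇ_; _<ᵇ_; _≤ᵇ_; _<?_; _≤?_; _≤′_; ≤′-refl; ≤′-step)
open import Data.Nat.Properties hiding (_≟_)
open import Data.Nat.Tactic.RingSolver using (solve-∀)
import Data.Nat.ListAction as ListAction
open import Algebra.Properties.Semiring.Sum +-*-semiring using (sum; sum-cong-≗; ∑-distrib-+; ∑-comm; *-distribˡ-sum; sum-replicate-zero)
open import Data.Bool using (Bool; true; false; _∧_; _∨_; not; if_then_else_) renaming (T to IsTrue; _≟_ to _≟ᵇ_)
open import Data.Empty using (⊥; ⊥-elim)
open import Data.Fin using (Fin; zero; suc; toℕ; fromℕ<; _≟_; finToFun; funToFin)
open import Data.Fin.Properties using (any?; all?; toℕ<n; toℕ-fromℕ<; toℕ-injective; finToFun-funToFin)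
open import Data.List using (allFin; tabulate)
import Data.List as List
open import Data.List.Properties using (map-tabulate)
open import Data.Product using (∃; _×_; _,_; proj₁; proj₂)
open import Data.Sum using (_⊎_; inj₁; inj₂)
open import Function using (_∘_; case_of_)
open import Function.Definitions using (Injective)
open import Relation.Nullary using (¬_; Dec; yes; no; does; _×-dec_; _→-dec_)
open import Relation.Nullary.Decidable using (dec-true; dec-false; map′)
open import Relation.Binary.Definitions using (tri<; tri≈; tri>)
open import Relation.Binary.PropositionalEquality renaming (sym to ≡-sym)

-- Counting subsets of Fin n

-- Boolean-valued, so that membership is decidable and the size `#` is a sum of indicators; counting
-- arguments become inequalities between sums.
Sub : ℕ → Set
Sub n = Fin n → Bool

infix 4 _∈_ _∉_ _⊆_
_∈_ _∉_ : ∀ {n} → Fin n → Sub n → Set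
x ∈ p = p x ≡ true
x ∉ p = p x ≡ false

_⊆_ : ∀ {n} → Sub n → Sub n → Set
p ⊆ q = ∀ x → x ∈ p → x ∈ q

infixr 7 _∩_
infixl 6 _∪_ _∖_ _-_
_∩_ _∪_ _∖_ : ∀ {n} → Sub n → Sub n → Sub n
(p ∩ q) x = p x ∧ q x
(p ∪ q) x = p x ∨ q x
(p ∖ q) x = p x ∧ not (q x)

full empty : ∀ {n} → Sub n
full _ = true
empty _ = false

infix 8 _==_
_==_ : ∀ {n} → Fin n → Fin n → Bool
a == b = does (a ≟ b)

_-_ : ∀ {n} → Sub n → Fin n → Sub n
p - v = p ∖ (v ==_)

==-refl : ∀ {n} (a : Fin n) → a == a ≡ true
==-refl a = dec-true (a ≟ a) refl

==⇒≡ : ∀ {n} (a b : Fin n) → a == b ≡ true → a ≡ b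
==⇒≡ a b e with a ≟ b
... | yes p = p

≢⇒== : ∀ {n} (a b : Fin n) → ¬ a ≡ b → a == b ≡ false
≢⇒== a b = dec-false (a ≟ b)

==-false⇒≢ : ∀ {n} (a b : Fin n) → a == b ≡ false → ¬ a ≡ b
==-false⇒≢ a b e refl = case trans (≡-sym e) (==-refl a) of λ ()

∧-intro : ∀ {a b} → a ≡ true → b ≡ true → a ∧ b ≡ true
∧-intro refl refl = refl

∧-left : ∀ {a b} → a ∧ b ≡ true → a ≡ true
∧-left {true} _ = refl

∧-right : ∀ {a b} → a ∧ b ≡ true → b ≡ true
∧-right {true} e = e

∨-left : ∀ {a b} → a ≡ true → a ∨ b ≡ true
∨-left refl = refl

∨-right : ∀ {a b} → b ≡ true → a ∨ b ≡ true
∨-right {true} refl = refl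
∨-right {false} refl = refl

∨-elim : ∀ {a b} → a ∨ b ≡ true → a ≡ true ⊎ b ≡ true
∨-elim {true} _ = inj₁ refl
∨-elim {false} e = inj₂ e

∨-left-false : ∀ {a b} → a ∨ b ≡ false → a ≡ false
∨-left-false {false} _ = refl

not-intro : ∀ {a} → a ≡ false → not a ≡ true
not-intro refl = refl

not-elim : ∀ {a} → not a ≡ true → a ≡ false
not-elim {false} _ = refl

true≢false : ∀ {a} → a ≡ true → a ≡ false → ⊥
true≢false refl ()

∈-dec : ∀ {n} (p : Sub n) x → x ∈ p ⊎ x ∉ p
∈-dec p x with p x
... | true = inj₁ refl
... | false = inj₂ refl

∈-remove : ∀ {n} (p : Sub n) v {x} → x ∈ p → ¬ v ≡ x → x ∈ p - v
∈-remove p v {x} x∈ ne = ∧-intro x∈ (not-intro (≢⇒== v x ne))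

∈-remove⁻ : ∀ {n} (p : Sub n) {v x} → x ∈ p - v → x ∈ p × ¬ v ≡ x
∈-remove⁻ p {v} {x} e = ∧-left e , ==-false⇒≢ v x (not-elim (∧-right {p x} e))

⟦_⟧ : Bool → ℕ
⟦ true ⟧ = 1
⟦ false ⟧ = 0

infix 9 #_
#_ : ∀ {n} → Sub n → ℕ
# p = sum (λ x → ⟦ p x ⟧)

⟦⟧-mono : ∀ {a b} → (a ≡ true → b ≡ true) → ⟦ a ⟧ ≤ ⟦ b ⟧
⟦⟧-mono {false} h = z≤n
⟦⟧-mono {true} h rewrite h refl = ≤-refl

⟦⟧-cancel-< : ∀ {a b} → ⟦ a ⟧ < ⟦ b ⟧ → b ≡ true × a ≡ false
⟦⟧-cancel-< {false} {true} _ = refl , refl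
⟦⟧-cancel-< {true} {true} (s≤s ())

⟦∧⟧ : ∀ a b → ⟦ a ∧ b ⟧ ≡ ⟦ a ⟧ * ⟦ b ⟧
⟦∧⟧ true b = ≡-sym (+-identityʳ _)
⟦∧⟧ false b = refl

sum-mono : ∀ {n} {f g : Fin n → ℕ} → (∀ i → f i ≤ g i) → sum f ≤ sum g
sum-mono {zero} h = z≤n
sum-mono {suc n} h = +-mono-≤ (h zero) (sum-mono (h ∘ suc))

-- Averaging. Free images and vertices of small degree are found through this inequality or its
-- consequence for sizes of sets.
sum-cancel-< : ∀ {n} {f g : Fin n → ℕ} → sum f < sum g → ∃ λ i → f i < g i
sum-cancel-< {f = f} {g} lt with any? (λ i → f i <? g i)
... | yes p = p
... | no np = ⊥-elim (<⇒≱ lt (sum-mono λ i → ≮⇒≥ (λ l → np (i , l))))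

sum-const-1 : ∀ n → sum {n} (λ _ → 1) ≡ n
sum-const-1 zero = refl
sum-const-1 (suc n) = cong suc (sum-const-1 n)

#-mono : ∀ {n} (p q : Sub n) → p ⊆ q → # p ≤ # q
#-mono p q h = sum-mono λ x → ⟦⟧-mono (h x)

#-cong : ∀ {n} (p q : Sub n) → p ⊆ q → q ⊆ p → # p ≡ # q
#-cong p q h h' = ≤-antisym (#-mono p q h) (#-mono q p h')

#-cancel-< : ∀ {n} (p q : Sub n) → # p < # q → ∃ λ x → x ∈ q × x ∉ p
#-cancel-< p q lt with sum-cancel-< {f = λ x → ⟦ p x ⟧} {λ x → ⟦ q x ⟧} lt
... | x , l = x , ⟦⟧-cancel-< l

#-empty : ∀ n → # (empty {n}) ≡ 0
#-empty = sum-replicate-zero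

#-pos : ∀ {n} (p : Sub n) → 0 < # p → ∃ λ x → x ∈ p
#-pos {n} p lt with #-cancel-< empty p (≤-trans (s≤s (≤-reflexive (#-empty n))) lt)
... | x , x∈ , _ = x , x∈

#-single : ∀ {n} (a : Fin n) → # (a ==_) ≡ 1
#-single {suc n} zero = cong suc (#-empty n)
#-single {suc n} (suc a) = #-single a

#-split : ∀ {n} (p q : Sub n) → # p ≡ # (p ∩ q) + # (p ∖ q)
#-split p q = trans (sum-cong-≗ λ x → lem (p x) (q x)) (∑-distrib-+ (λ x → ⟦ p x ∧ q x ⟧) (λ x → ⟦ p x ∧ not (q x) ⟧))
  where
  lem : ∀ a b → ⟦ a ⟧ ≡ ⟦ a ∧ b ⟧ + ⟦ a ∧ not b ⟧
  lem true true = refl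
  lem true false = refl
  lem false _ = refl

#-∖-≤ : ∀ {n} (p q : Sub n) → # p ≤ # q + # (p ∖ q)
#-∖-≤ p q = ≤-trans (≤-reflexive (#-split p q)) (+-monoˡ-≤ _ (#-mono (p ∩ q) q λ x → ∧-right {p x}))

#-∪-≤ : ∀ {n} (p q : Sub n) → # (p ∪ q) ≤ # p + # q
#-∪-≤ p q = ≤-trans (sum-mono λ x → lem (p x) (q x)) (≤-reflexive (∑-distrib-+ (λ x → ⟦ p x ⟧) (λ x → ⟦ q x ⟧)))
  where
  lem : ∀ a b → ⟦ a ∨ b ⟧ ≤ ⟦ a ⟧ + ⟦ b ⟧
  lem true b = s≤s z≤n
  lem false b = ≤-refl

#-∖ : ∀ {n} (p q : Sub n) → q ⊆ p → # p ≡ # q + # (p ∖ q)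
#-∖ p q h = trans (#-split p q)
  (cong (_+ # (p ∖ q)) (#-cong (p ∩ q) q (λ x → ∧-right {p x}) (λ x e → ∧-intro (h x e) e)))

#-remove : ∀ {n} (p : Sub n) v → v ∈ p → # p ≡ suc (# (p - v))
#-remove p v v∈ = trans (#-∖ p (v ==_) λ x e → subst (_∈ p) (==⇒≡ v x e) v∈)
  (cong (_+ # (p - v)) (#-single v))

#-insert : ∀ {n} (p : Sub n) v → v ∉ p → # (p ∪ (v ==_)) ≡ suc (# p)
#-insert p v v∉ = trans (#-remove (p ∪ (v ==_)) v (∨-right {p v} (==-refl v))) (cong suc (#-cong ((p ∪ (v ==_)) - v) p to from))
  where
  to : (p ∪ (v ==_)) - v ⊆ p
  to x e with ∨-elim {p x} (∧-left e)
  ... | inj₁ h = h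
  ... | inj₂ h = ⊥-elim (true≢false h (not-elim (∧-right {p x ∨ v == x} e)))
  from : p ⊆ (p ∪ (v ==_)) - v
  from x e = ∧-intro (∨-left e) (not-intro (≢⇒== v x λ { refl → true≢false e v∉ }))

#-full : ∀ n → # (full {n}) ≡ n
#-full = sum-const-1

#≤n : ∀ {n} (p : Sub n) → # p ≤ n
#≤n {n} p = ≤-trans (#-mono p full λ _ _ → refl) (≤-reflexive (#-full n))

#-complement : ∀ {n} (p : Sub n) → n ≡ # p + # (full ∖ p)
#-complement {n} p = trans (≡-sym (#-full n)) (#-∖ full p λ _ _ → refl)

#≤1 : ∀ {n} (p : Sub n) → (∀ x y → x ∈ p → y ∈ p → x ≡ y) → # p ≤ 1
#≤1 p h with 0 <? # p
... | no np = ≤-trans (≮⇒≥ np) z≤n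
... | yes lt with #-pos p lt
... | x , x∈ = ≤-trans (#-mono p (x ==_) λ y y∈ → subst (λ z → x == z ≡ true) (h x y x∈ y∈) (==-refl x))
  (≤-reflexive (#-single x))

#≥2 : ∀ {n} (p : Sub n) a b → a ∈ p → b ∈ p → ¬ a ≡ b → 2 ≤ # p
#≥2 p a b a∈ b∈ ab = ≤-trans (s≤s (≤-trans (s≤s z≤n) (≤-reflexive (≡-sym (#-remove (p - a) b (∈-remove p a b∈ ab))))))
  (≤-reflexive (≡-sym (#-remove p a a∈)))

#≥3 : ∀ {n} (p : Sub n) a b c → a ∈ p → b ∈ p → c ∈ p → ¬ a ≡ b → ¬ a ≡ c → ¬ b ≡ c → 3 ≤ # p
#≥3 p a b c a∈ b∈ c∈ ab ac bc = ≤-trans (s≤s (#≥2 (p - a) b c (∈-remove p a b∈ ab) (∈-remove p a c∈ ac) bc))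
  (≤-reflexive (≡-sym (#-remove p a a∈)))

exists : ∀ {n} → Sub n → Bool
exists p = does (any? λ x → p x ≟ᵇ true)

exists-intro : ∀ {n} (p : Sub n) x → x ∈ p → exists p ≡ true
exists-intro p x e = dec-true (any? λ x → p x ≟ᵇ true) (x , e)

exists-elim : ∀ {n} (p : Sub n) → exists p ≡ true → ∃ λ x → x ∈ p
exists-elim p e with any? (λ x → p x ≟ᵇ true)
... | yes h = h

exists-false : ∀ {n} (p : Sub n) → exists p ≡ false → ∀ x → x ∉ p
exists-false p e x with p x in eq
... | false = refl
... | true = ⊥-elim (true≢false (exists-intro p x eq) e)

sum-≥ : ∀ {n} (f : Fin n → ℕ) x → f x ≤ sum f
sum-≥ f zero = m≤m+n _ _
sum-≥ f (suc x) = ≤-trans (sum-≥ (f ∘ suc) x) (m≤n+m _ _)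

-- The union of the sets `R x` over `x` in `S`. Images of maps and neighbourhoods of sets are
-- instances.
bind : ∀ {m n} → Sub m → (Fin m → Sub n) → Sub n
bind S R y = exists λ x → S x ∧ R x y

#-bind : ∀ {m n} (S : Sub m) (R : Fin m → Sub n) → # (bind S R) ≤ sum (λ x → ⟦ S x ⟧ * # (R x))
#-bind S R = begin
  # (bind S R)                                       ≤⟨ sum-mono pointwise ⟩
  sum (λ y → sum λ x → ⟦ S x ⟧ * ⟦ R x y ⟧)          ≡⟨ ∑-comm (λ y x → ⟦ S x ⟧ * ⟦ R x y ⟧) ⟩
  sum (λ x → sum λ y → ⟦ S x ⟧ * ⟦ R x y ⟧)          ≡⟨ sum-cong-≗ (λ x → ≡-sym (*-distribˡ-sum ⟦ S x ⟧ (λ y → ⟦ R x y ⟧))) ⟩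
  sum (λ x → ⟦ S x ⟧ * # (R x))                      ∎
  where
  open ≤-Reasoning
  pointwise : ∀ y → ⟦ bind S R y ⟧ ≤ sum λ x → ⟦ S x ⟧ * ⟦ R x y ⟧
  pointwise y with bind S R y in eq
  ... | false = z≤n
  ... | true with exists-elim (λ x → S x ∧ R x y) eq
  ... | x , e = ≤-trans (≤-reflexive (cong ⟦_⟧ (≡-sym e)))
    (≤-trans (≤-reflexive (⟦∧⟧ (S x) (R x y))) (sum-≥ (λ x → ⟦ S x ⟧ * ⟦ R x y ⟧) x))

image : ∀ {m n} → (Fin m → Fin n) → Sub m → Sub n
image f S = bind S (λ x → f x ==_)

∈-image : ∀ {m n} (f : Fin m → Fin n) (S : Sub m) {x} → x ∈ S → f x ∈ image f S
∈-image f S {x} e = exists-intro (λ z → S z ∧ f z == f x) x (∧-intro e (==-refl (f x)))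

∉-image : ∀ {m n} (f : Fin m → Fin n) (S : Sub m) {x y} → y ∉ image f S → x ∈ S → ¬ f x ≡ y
∉-image f S y∉ x∈ refl = true≢false (∈-image f S x∈) y∉

#-weighted-≤ : ∀ {n} (S : Sub n) (f : Fin n → ℕ) D → (∀ x → x ∈ S → f x ≤ D) → sum (λ x → ⟦ S x ⟧ * f x) ≤ # S * D
#-weighted-≤ S f D h = ≤-trans (sum-mono pointwise)
  (≤-reflexive (trans (sum-cong-≗ λ x → *-comm ⟦ S x ⟧ D) (trans (≡-sym (*-distribˡ-sum D (λ x → ⟦ S x ⟧))) (*-comm D (# S)))))
  where
  pointwise : ∀ x → ⟦ S x ⟧ * f x ≤ ⟦ S x ⟧ * D
  pointwise x with S x in eq
  ... | true = *-monoʳ-≤ 1 (h x eq)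
  ... | false = z≤n

#-image-≤ : ∀ {m n} (f : Fin m → Fin n) (S : Sub m) → # (image f S) ≤ # S
#-image-≤ f S = ≤-trans (#-bind S (λ x → f x ==_))
  (≤-trans (#-weighted-≤ S (λ x → # (f x ==_)) 1 λ x _ → ≤-reflexive (#-single (f x))) (≤-reflexive (*-identityʳ (# S))))

-- The pairs `(x , h x)` are counted twice: every row over `S` has one, and a column has at most one
-- inside `Q` and none outside.
#-injective-≤ : ∀ {m n} (S : Sub m) (Q : Sub n) (h : Fin m → Fin n) → (∀ x → x ∈ S → h x ∈ Q) →
  (∀ x y → x ∈ S → y ∈ S → h x ≡ h y → x ≡ y) → # S ≤ # Q
#-injective-≤ {n = n} S Q h into inj = begin
  # S                                              ≡⟨ sum-cong-≗ (λ x → row x) ⟩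
  sum (λ x → sum λ y → ⟦ S x ∧ h x == y ⟧)          ≡⟨ ∑-comm (λ x y → ⟦ S x ∧ h x == y ⟧) ⟩
  sum (λ y → # (λ x → S x ∧ h x == y))             ≤⟨ sum-mono column ⟩
  # Q                                              ∎
  where
  open ≤-Reasoning
  row : ∀ x → ⟦ S x ⟧ ≡ sum λ y → ⟦ S x ∧ h x == y ⟧
  row x with S x
  ... | true = ≡-sym (#-single (h x))
  ... | false = ≡-sym (#-empty n)
  column : ∀ y → # (λ x → S x ∧ h x == y) ≤ ⟦ Q y ⟧
  column y with Q y in eq
  ... | true = #≤1 (λ x → S x ∧ h x == y) λ x x' e e' → inj x x' (∧-left e) (∧-left e')
    (trans (==⇒≡ (h x) y (∧-right {S x} e)) (≡-sym (==⇒≡ (h x') y (∧-right {S x'} e'))))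
  ... | false with 0 <? # (λ x → S x ∧ h x == y)
  ... | no np = ≮⇒≥ np
  ... | yes lt with #-pos (λ x → S x ∧ h x == y) lt
  ... | x , e = ⊥-elim (true≢false (subst (_∈ Q) (==⇒≡ (h x) y (∧-right {S x} e)) (into x (∧-left e))) eq)

subset-of-size : ∀ {n} (p : Sub n) m → m ≤ # p → ∃ λ q → q ⊆ p × # q ≡ m
subset-of-size {n} p zero _ = empty , (λ x ()) , #-empty n
subset-of-size p (suc m) lt with #-pos p (≤-trans (s≤s z≤n) lt)
... | v , v∈ with subset-of-size (p - v) m (s≤s⁻¹ (≤-trans lt (≤-reflexive (#-remove p v v∈))))
... | q , q⊆ , #q = q ∪ (v ==_) , sub , trans (#-insert q v v∉) (cong suc #q)
  where
  v∉ : v ∉ q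
  v∉ with ∈-dec q v
  ... | inj₂ h = h
  ... | inj₁ h = ⊥-elim (proj₂ (∈-remove⁻ p (q⊆ v h)) refl)
  sub : q ∪ (v ==_) ⊆ p
  sub x e with ∨-elim {q x} e
  ... | inj₁ h = ∧-left (q⊆ x h)
  ... | inj₂ h = subst (_∈ p) (==⇒≡ v x h) v∈

enumerate : ∀ {n} (p : Sub n) m → m ≤ # p →
  ∃ λ (f : Fin m → Fin n) → (∀ i → f i ∈ p) × (∀ i j → f i ≡ f j → i ≡ j)
enumerate p zero _ = (λ ()) , (λ ()) , λ ()
enumerate {n} p (suc m) lt with #-pos p (≤-trans (s≤s z≤n) lt)
... | v , v∈ with enumerate (p - v) m (s≤s⁻¹ (≤-trans lt (≤-reflexive (#-remove p v v∈))))
... | f , f∈ , inj = g , g∈ , ginj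
  where
  g : Fin (suc m) → Fin n
  g zero = v
  g (suc i) = f i
  g∈ : ∀ i → g i ∈ p
  g∈ zero = v∈
  g∈ (suc i) = ∧-left (f∈ i)
  ginj : ∀ i j → g i ≡ g j → i ≡ j
  ginj zero zero e = refl
  ginj zero (suc j) e = ⊥-elim (proj₂ (∈-remove⁻ p (f∈ j)) e)
  ginj (suc i) zero e = ⊥-elim (proj₂ (∈-remove⁻ p (f∈ i)) (≡-sym e))
  ginj (suc i) (suc j) e = cong suc (inj i j e)

-- Greedy embeddings

isRed isBlue : Colour → Bool
isRed red = true
isRed blue = false
isBlue c = not (isRed c)

deg : ∀ {n} → Graph n → Sub n → Fin n → ℕ
deg G S x = # (S ∩ Adj G x)

degSum : ∀ {n} → Graph n → Sub n → ℕ
degSum G S = sum λ x → ⟦ S x ⟧ * deg G S x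

-- degSum counts edges twice, so this says that every S ⊆ A spans at most # S + l edges.
Sparse : ∀ {n} → ℕ → Graph n → Sub n → Set
Sparse l G A = ∀ S → S ⊆ A → degSum G S ≤ 2 * (# S + l)

_[_↦_] : ∀ {n} {X : Set} → (Fin n → X) → Fin n → X → Fin n → X
(f [ v ↦ y ]) x = if v == x then y else f x

update-same : ∀ {n} {X : Set} (f : Fin n → X) v y {x} → v ≡ x → (f [ v ↦ y ]) x ≡ y
update-same f v y refl rewrite ==-refl v = refl

update-other : ∀ {n} {X : Set} (f : Fin n → X) v y {x} → ¬ v ≡ x → (f [ v ↦ y ]) x ≡ f x
update-other f v y {x} ne rewrite ≢⇒== v x ne = refl

-- The vertices outside `P` have degrees in `S` that sum to at most `2 * (# S + l)`, so one of them
-- does not exceed the average. The product form avoids division.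
sparse-min-degree : ∀ {n} (G : Graph n) l P S i → degSum G S ≤ 2 * (# S + l) → # (S ∖ P) ≡ suc i →
  ∃ λ v → v ∈ S ∖ P × deg G S v * suc i ≤ 2 * (# S + l)
sparse-min-degree G l P S i sparse size
  with sum-cancel-< {f = λ x → suc i * (⟦ (S ∖ P) x ⟧ * deg G S x)} {λ x → suc (2 * (# S + l)) * ⟦ (S ∖ P) x ⟧} bound
  where
  open ≤-Reasoning
  C = 2 * (# S + l)
  weaker : ∀ a b m → ⟦ a ∧ not b ⟧ * m ≤ ⟦ a ⟧ * m
  weaker a b m = *-monoˡ-≤ m (⟦⟧-mono {a ∧ not b} {a} ∧-left)
  -- Raising `C` to `suc C` makes the comparison strict, as averaging requires; at the vertex found,
  -- strictness gives back the bound by `C`.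
  bound : sum (λ x → suc i * (⟦ (S ∖ P) x ⟧ * deg G S x)) < sum (λ x → suc C * ⟦ (S ∖ P) x ⟧)
  bound = begin-strict
    sum (λ x → suc i * (⟦ (S ∖ P) x ⟧ * deg G S x)) ≡⟨ *-distribˡ-sum (suc i) (λ x → ⟦ (S ∖ P) x ⟧ * deg G S x) ⟨
    suc i * sum (λ x → ⟦ (S ∖ P) x ⟧ * deg G S x)   ≤⟨ *-monoʳ-≤ (suc i) (sum-mono λ x → weaker (S x) (P x) (deg G S x)) ⟩
    suc i * degSum G S                              ≤⟨ *-monoʳ-≤ (suc i) sparse ⟩
    suc i * C                                       <⟨ *-monoʳ-< (suc i) ≤-refl ⟩
    suc i * suc C                                   ≡⟨ *-comm (suc i) (suc C) ⟩
    suc C * suc i                                   ≡⟨ cong (suc C *_) size ⟨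
    suc C * # (S ∖ P)                               ≡⟨ *-distribˡ-sum (suc C) (λ x → ⟦ (S ∖ P) x ⟧) ⟩
    sum (λ x → suc C * ⟦ (S ∖ P) x ⟧)               ∎
... | v , lt with (S ∖ P) v in eq
... | false = ⊥-elim (n≮0 (≤-trans lt (≤-reflexive (*-zeroʳ (suc (2 * (# S + l)))))))
... | true = v , eq , s≤s⁻¹ (begin-strict
    deg G S v * suc i              ≡⟨ lem i (deg G S v) ⟩
    suc i * (1 * deg G S v)        <⟨ lt ⟩
    suc (2 * (# S + l)) * 1        ≡⟨ *-identityʳ _ ⟩
    suc (2 * (# S + l))            ∎)
  where
  open ≤-Reasoning
  lem : ∀ i d → d * suc i ≡ suc i * (1 * d)
  lem i d = trans (*-comm d (suc i)) (cong (suc i *_) (≡-sym (*-identityˡ d)))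

neighbour-≢ : ∀ {n} (G : Graph n) v x → Adj G v x ≡ true → ¬ v ≡ x
neighbour-≢ G v x e refl = true≢false e (irrefl G v)

deg<# : ∀ {n} (G : Graph n) S v → v ∈ S → deg G S v < # S
deg<# G S v v∈ = ≤-trans (s≤s (#-mono (S ∩ Adj G v) (S - v)
  λ x e → ∈-remove S v (∧-left e) (neighbour-≢ G v x (∧-right {S x} e)))) (≤-reflexive (≡-sym (#-remove S v v∈)))

module Colours {N} (χ : Colouring N) where

  R B : Fin N → Sub N
  R u y = not (u == y) ∧ isRed (col χ u y)
  B u y = not (u == y) ∧ isBlue (col χ u y)

  R-sym : ∀ u y → y ∈ R u → u ∈ R y
  R-sym u y e = ∧-intro
    (not-intro (≢⇒== y u λ { refl → true≢false (==-refl u) (not-elim (∧-left e)) }))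
    (trans (cong isRed (colSym χ y u)) (∧-right {not (u == y)} e))

  B-sym : ∀ u y → y ∈ B u → u ∈ B y
  B-sym u y e = ∧-intro
    (not-intro (≢⇒== y u λ { refl → true≢false (==-refl u) (not-elim (∧-left e)) }))
    (trans (cong isBlue (colSym χ y u)) (∧-right {not (u == y)} e))

  R-≢ : ∀ u y → y ∈ R u → ¬ u ≡ y
  R-≢ u y e refl = true≢false (==-refl u) (not-elim (∧-left e))

  B-≢ : ∀ u y → y ∈ B u → ¬ u ≡ y
  B-≢ u y e refl = true≢false (==-refl u) (not-elim (∧-left e))

  R⊎B : ∀ u y → ¬ u ≡ y → y ∈ R u ⊎ y ∈ B u
  R⊎B u y ne rewrite ≢⇒== u y ne with col χ u y
  ... | red = inj₁ refl
  ... | blue = inj₂ refl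

  colours-cover : ∀ u → full ⊆ (u ==_) ∪ (B u ∪ R u)
  colours-cover u y _ = by-case (u ≟ y)
    where
    by-case : Dec (u ≡ y) → y ∈ (u ==_) ∪ (B u ∪ R u)
    by-case (yes e) = ∨-left (subst (λ z → u == z ≡ true) e (==-refl u))
    by-case (no ne) with R⊎B u y ne
    ... | inj₁ h = ∨-right {u == y} (∨-right {B u y} h)
    ... | inj₂ h = ∨-right {u == y} (∨-left h)

  R-B : ∀ u y → y ∈ R u → y ∈ B u → ⊥
  R-B u y r b with col χ u y | ∧-right {not (u == y)} r | ∧-right {not (u == y)} b
  ... | red | _ | ()
  ... | blue | () | _

  R⇒red : ∀ u y → y ∈ R u → col χ u y ≡ red
  R⇒red u y r with col χ u y | ∧-right {not (u == y)} r
  ... | red | _ = refl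

  B⇒blue : ∀ u y → y ∈ B u → col χ u y ≡ blue
  B⇒blue u y r with col χ u y | ∧-right {not (u == y)} r
  ... | blue | _ = refl

  -- `f` is total with arbitrary values outside `A`, so that an embedding is extended by changing
  -- one value.
  record Emb {n} (G : Graph n) (A : Sub n) (f : Fin n → Fin N) : Set where
    constructor emb
    field
      injective : ∀ x y → x ∈ A → y ∈ A → f x ≡ f y → x ≡ y
      edges : ∀ x y → x ∈ A → y ∈ A → Adj G x y ≡ true → f y ∈ R (f x)
  open Emb public

  emb-empty : ∀ {n} (G : Graph n) f → Emb G empty f
  emb-empty G f = emb (λ x y ()) (λ x y ())

  emb-⊆ : ∀ {n} {G : Graph n} {A A' f} → A' ⊆ A → Emb G A f → Emb G A' f
  emb-⊆ sub (emb inj ed) = emb (λ x y a b → inj x y (sub x a) (sub y b)) (λ x y a b → ed x y (sub x a) (sub y b))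

  extend : ∀ {n} (G : Graph n) A v f y → Emb G (A - v) f → y ∉ image f (A - v) →
    (∀ x → x ∈ A - v → Adj G v x ≡ true → y ∈ R (f x)) → Emb G A (f [ v ↦ y ])
  extend G A v f y (emb inj ed) fresh red-to = emb inj′ ed′
    where
    g = f [ v ↦ y ]
    data View x : Set where
      new : v ≡ x → g x ≡ y → View x
      old : x ∈ A - v → g x ≡ f x → View x
    view : ∀ x → x ∈ A → View x
    view x x∈ with v ≟ x
    ... | yes p = new p (update-same f v y p)
    ... | no np = old (∈-remove A v x∈ np) (update-other f v y np)
    inj′ : ∀ x z → x ∈ A → z ∈ A → g x ≡ g z → x ≡ z
    inj′ x z x∈ z∈ e with view x x∈ | view z z∈
    ... | new p _ | new q _ = trans (≡-sym p) q
    ... | new _ p | old z∈' q = ⊥-elim (∉-image f (A - v) fresh z∈' (trans (≡-sym q) (trans (≡-sym e) p)))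
    ... | old x∈' q | new _ p = ⊥-elim (∉-image f (A - v) fresh x∈' (trans (≡-sym q) (trans e p)))
    ... | old x∈' p | old z∈' q = inj x z x∈' z∈' (trans (≡-sym p) (trans e q))
    ed′ : ∀ x z → x ∈ A → z ∈ A → Adj G x z ≡ true → g z ∈ R (g x)
    ed′ x z x∈ z∈ e with view x x∈ | view z z∈
    ... | new refl _ | new refl _ = ⊥-elim (true≢false e (irrefl G v))
    ... | new refl p | old z∈' q = subst₂ (λ a b → b ∈ R a) (≡-sym p) (≡-sym q) (R-sym (f z) y (red-to z z∈' e))
    ... | old x∈' q | new refl p = subst₂ (λ a b → b ∈ R a) (≡-sym q) (≡-sym p) (red-to x x∈' (trans (Graph.sym G v x) e))
    ... | old x∈' p | old z∈' q = subst₂ (λ a b → b ∈ R a) (≡-sym p) (≡-sym q) (ed x z x∈' z∈' e)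

  -- A vertex outside `P` of small degree is taken out, the rest is embedded, and the vertex is put
  -- back. With `b` neighbours it has to avoid the used vertices and at most `b * Δ` blue neighbours
  -- of their images; `room` guarantees that the host has a vertex left. The host may grow with the
  -- stage, which `base` exploits.
  module Greedy {n} (G : Graph n) (l : ℕ) (A P : Sub n) (sparse : Sparse l G A)
    (f₀ : Fin n → Fin N) (emb₀ : Emb G P f₀)
    (Host : ℕ → Sub N) (Δ : ℕ → ℕ) (host-mono : ∀ i → Host i ⊆ Host (suc i))
    (host₀ : ∀ x → x ∈ P → f₀ x ∈ Host 0)
    (host-blue : ∀ i y → y ∈ Host i → # (Host i ∩ B y) ≤ Δ i)
    (room : ∀ i b → # P + suc i ≤ # A → b < # P + suc i → b * suc i ≤ 2 * (# P + suc i + l) →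
            # P + suc i + b * Δ (suc i) ≤ # (Host (suc i)))
    where

    Extension : ℕ → Sub n → Set
    Extension i S = ∃ λ f → Emb G S f × (∀ x → x ∈ S → f x ∈ Host i) × (∀ x → x ∈ P → f x ≡ f₀ x)

    greedy : ∀ i S → P ⊆ S → S ⊆ A → # S ≡ # P + i → Extension i S
    greedy zero S P⊆S S⊆A size = f₀ , emb-⊆ S⊆P emb₀ , (λ x x∈ → host₀ x (S⊆P x x∈)) , λ _ _ → refl
      where
      S⊆P : S ⊆ P
      S⊆P x x∈ with ∈-dec P x
      ... | inj₁ h = h
      ... | inj₂ x∉ = ⊥-elim (<-irrefl (≡-sym size) (≤-trans (s≤s (≤-reflexive (+-identityʳ (# P))))
        (≤-trans (s≤s (#-mono P (S - x) λ y y∈ → ∈-remove S x (P⊆S y y∈) λ { refl → true≢false y∈ x∉ }))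
          (≤-reflexive (≡-sym (#-remove S x x∈))))))
    greedy (suc i) S P⊆S S⊆A size
      with sparse-min-degree G l P S i (sparse S S⊆A)
        (+-cancelˡ-≡ (# P) _ _ (trans (≡-sym (#-∖ S P P⊆S)) size))
    ... | v , v∈ , dv
      with greedy i (S - v) (λ x x∈ → ∈-remove S v (P⊆S x x∈) λ { refl → true≢false x∈ (not-elim (∧-right {S v} v∈)) })
        (λ x e → S⊆A x (∧-left e))
        (suc-injective (trans (≡-sym (#-remove S v (∧-left v∈))) (trans size (+-suc (# P) i))))
    ... | f , emb-f , in-host , agrees = choose (#-cancel-< bad H bad<H)
      where
      H = Host (suc i)
      used = image f (S - v)
      nbrs = S ∩ Adj G v
      blocked = bind nbrs (λ x → H ∩ B (f x))
      bad = used ∪ blocked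
      in-rest : ∀ x → x ∈ nbrs → x ∈ S - v
      in-rest x e = ∈-remove S v (∧-left e) (neighbour-≢ G v x (∧-right {S x} e))
      b = deg G S v
      open ≤-Reasoning
      bad<H : # bad < # H
      bad<H = begin-strict
        # bad                                       ≤⟨ #-∪-≤ used blocked ⟩
        # used + # blocked                          ≤⟨ +-mono-≤ (#-image-≤ f (S - v)) (#-bind nbrs (λ x → H ∩ B (f x))) ⟩
        # (S - v) + sum (λ x → ⟦ nbrs x ⟧ * # (H ∩ B (f x)))
          ≤⟨ +-monoʳ-≤ (# (S - v)) (#-weighted-≤ nbrs (λ x → # (H ∩ B (f x))) (Δ (suc i))
               λ x e → host-blue (suc i) (f x) (host-mono i (f x) (in-host x (in-rest x e)))) ⟩
        # (S - v) + b * Δ (suc i)                   <⟨ ≤-refl ⟩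
        suc (# (S - v)) + b * Δ (suc i)             ≡⟨ cong (_+ b * Δ (suc i)) (trans (≡-sym (#-remove S v (∧-left v∈))) size) ⟩
        # P + suc i + b * Δ (suc i)                 ≤⟨ room i b (≤-trans (≤-reflexive (≡-sym size)) (#-mono S A S⊆A))
                                                        (≤-trans (deg<# G S v (∧-left v∈)) (≤-reflexive size))
                                                        (subst (λ s → b * suc i ≤ 2 * (s + l)) size dv) ⟩
        # H                                         ∎
      choose : (∃ λ y → y ∈ H × y ∉ bad) → Extension (suc i) S
      choose (y , y∈ , y∉) = f [ v ↦ y ] , extend G S v f y emb-f y∉used red-to , in-host′ , agrees′
        where
        y∉used : y ∉ used
        y∉used = ∨-left-false y∉
        red-to : ∀ x → x ∈ S - v → Adj G v x ≡ true → y ∈ R (f x)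
        red-to x x∈ e with R⊎B (f x) y (∉-image f (S - v) y∉used x∈)
        ... | inj₁ r = r
        ... | inj₂ bl = ⊥-elim (true≢false (∨-right {used y} (exists-intro (λ x → nbrs x ∧ (H ∩ B (f x)) y) x
          (∧-intro (∧-intro (∧-left {S x} x∈) e) (∧-intro y∈ bl)))) y∉)
        in-host′ : ∀ x → x ∈ S → (f [ v ↦ y ]) x ∈ H
        in-host′ x x∈ with v ≟ x
        ... | yes _ = y∈
        ... | no np = host-mono i (f x) (in-host x (∈-remove S v x∈ np))
        agrees′ : ∀ x → x ∈ P → (f [ v ↦ y ]) x ≡ f₀ x
        agrees′ x x∈ = trans (update-other f v y λ { refl → true≢false x∈ (not-elim (∧-right {S v} v∈)) }) (agrees x x∈)

-- Suspended paths and leaves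

-- Connectivity of the subgraph induced by `A`. In terms of closed sets it passes to a smaller graph
-- by enlarging a set, whereas walks would have to be rerouted.
Conn : ∀ {n} → Graph n → Sub n → Set
Conn G A = ∀ S x → x ∈ S → S ⊆ A →
  (∀ u v → u ∈ S → v ∈ A → Adj G u v ≡ true → v ∈ S) → A ⊆ S

adj-sym : ∀ {n} (G : Graph n) x y → Adj G x y ≡ true → Adj G y x ≡ true
adj-sym G x y e = trans (Graph.sym G y x) e

-- This serves both reductions. A leaf has a single neighbour, and `G′` is `G`; for an interior path
-- vertex, `G′` contains the edge between its two neighbours.
conn-remove : ∀ {n} (G G′ : Graph n) A v → Conn G A →
  (∀ x y → Adj G x y ≡ true → Adj G′ x y ≡ true) →
  (∀ x y → x ∈ A - v → y ∈ A - v → Adj G v x ≡ true → Adj G v y ≡ true → x ≡ y ⊎ Adj G′ x y ≡ true) →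
  Conn G′ (A - v)
conn-remove G G′ A v conn more bridge S x x∈ S⊆ closed w w∈ = result
  where
  w-in : w ∈ A × ¬ v ≡ w
  w-in = ∈-remove⁻ A w∈
  -- A set closed in G′ stays closed in G if v is added whenever it has a neighbour in the set.
  S⁺ : Sub _
  S⁺ y = S y ∨ (v == y ∧ (A v ∧ exists (S ∩ Adj G v)))
  S⁺⊆ : S⁺ ⊆ A
  S⁺⊆ y e with ∨-elim {S y} e
  ... | inj₁ h = ∧-left (S⊆ y h)
  ... | inj₂ h = subst (_∈ A) (==⇒≡ v y (∧-left h)) (∧-left (∧-right {v == y} h))
  closed⁺ : ∀ u y → u ∈ S⁺ → y ∈ A → Adj G u y ≡ true → y ∈ S⁺
  closed⁺ u y u∈ y∈ e with ∨-elim {S u} u∈ | v ≟ y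
  ... | inj₁ h | no ne = ∨-left (closed u y h (∈-remove A v y∈ ne) (more u y e))
  ... | inj₁ h | yes refl = ∨-right {S v} (∧-intro refl
    (∧-intro y∈ (exists-intro (S ∩ Adj G v) u (∧-intro h (adj-sym G u v e)))))
  ... | inj₂ h | yes refl = ⊥-elim (neighbour-≢ G u v e (≡-sym (==⇒≡ v u (∧-left h))))
  ... | inj₂ h | no ne with ==⇒≡ v u (∧-left h) | exists-elim (S ∩ Adj G v) (∧-right {A v} (∧-right {v == u} h))
  ... | refl | z , z∈ with bridge z y (S⊆ z (∧-left {S z} z∈)) (∈-remove A v y∈ ne) (∧-right {S z} z∈) e
  ... | inj₁ refl = ∨-left (∧-left {S z} z∈)
  ... | inj₂ e′ = ∨-left (closed z y (∧-left {S z} z∈) (∈-remove A v y∈ ne) e′)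
  result : w ∈ S
  result with ∨-elim {S w} (conn S⁺ x (∨-left x∈) S⁺⊆ closed⁺ w (proj₁ w-in))
  ... | inj₁ h = h
  ... | inj₂ h = ⊥-elim (proj₂ w-in (==⇒≡ v w (∧-left h)))

sparse-⊆ : ∀ {n} {l} {G : Graph n} {A A′} → A′ ⊆ A → Sparse l G A → Sparse l G A′
sparse-⊆ sub sparse S S⊆ = sparse S (λ x e → sub x (S⊆ x e))

-- Followed by the removal of a vertex of degree 2 with neighbours `a` and `b`, this contracts an
-- edge at that vertex. If `a` and `b` are adjacent already, no adjacency changes.
addEdge : ∀ {n} (G : Graph n) a b → ¬ a ≡ b → Graph n
addEdge G a b a≢b = record { Adj = adj ; sym = symm ; irrefl = irr }
  where
  adj : _ → _ → Bool
  adj x y = Adj G x y ∨ (a == x ∧ b == y ∨ b == x ∧ a == y)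
  swap : ∀ p q r s → p ∧ q ∨ r ∧ s ≡ s ∧ r ∨ q ∧ p
  swap true true true true = refl
  swap true true true false = refl
  swap true true false true = refl
  swap true true false false = refl
  swap true false true true = refl
  swap true false true false = refl
  swap true false false true = refl
  swap true false false false = refl
  swap false true true true = refl
  swap false true true false = refl
  swap false true false true = refl
  swap false true false false = refl
  swap false false true true = refl
  swap false false true false = refl
  swap false false false true = refl
  swap false false false false = refl
  symm : ∀ x y → adj x y ≡ adj y x
  symm x y = cong₂ _∨_ (Graph.sym G x y) (swap (a == x) (b == y) (b == x) (a == y))
  irr : ∀ x → adj x x ≡ false
  irr x with a ≟ x | b ≟ x
  ... | yes refl | yes refl = ⊥-elim (a≢b refl)
  ... | yes _ | no _ rewrite irrefl G x = refl
  ... | no _ | yes _ rewrite irrefl G x = refl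
  ... | no _ | no _ rewrite irrefl G x = refl

addEdge-elim : ∀ {n} (G : Graph n) a b ne x y → Adj (addEdge G a b ne) x y ≡ true →
  Adj G x y ≡ true ⊎ (a ≡ x × b ≡ y) ⊎ (b ≡ x × a ≡ y)
addEdge-elim G a b ne x y e with ∨-elim {Adj G x y} e
... | inj₁ h = inj₁ h
... | inj₂ h with ∨-elim {a == x ∧ b == y} h
... | inj₁ h′ = inj₂ (inj₁ (==⇒≡ a x (∧-left h′) , ==⇒≡ b y (∧-right {a == x} h′)))
... | inj₂ h′ = inj₂ (inj₂ (==⇒≡ b x (∧-left h′) , ==⇒≡ a y (∧-right {b == x} h′)))

addEdge-new : ∀ {n} (G : Graph n) a b ne → Adj (addEdge G a b ne) a b ≡ true
addEdge-new G a b ne = ∨-right {Adj G a b} (∨-left (∧-intro (==-refl a) (==-refl b)))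

degSum-mono : ∀ {n} (G G′ : Graph n) S → (∀ x y → x ∈ S → y ∈ S → Adj G x y ≡ true → Adj G′ x y ≡ true) →
  degSum G S ≤ degSum G′ S
degSum-mono G G′ S h = sum-mono pointwise
  where
  pointwise : ∀ x → ⟦ S x ⟧ * deg G S x ≤ ⟦ S x ⟧ * deg G′ S x
  pointwise x with S x in eq
  ... | false = z≤n
  ... | true = *-monoʳ-≤ 1 (#-mono (S ∩ Adj G x) (S ∩ Adj G′ x)
    λ y e → ∧-intro (∧-left e) (h x y eq (∧-left e) (∧-right {S y} e)))

-- If `S` contains `a` and `b`, it is compared with `S` enlarged by `v`: the edges from `v` to `a`
-- and `b` replace the edge `ab`, so one more vertex comes with at least one more edge. Otherwise
-- the new edge does not lie within `S`.
sparse-contract : ∀ {n} (G : Graph n) l A v a b (ne : ¬ a ≡ b) → Sparse l G A → v ∈ A →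
  Adj G v a ≡ true → Adj G v b ≡ true → Sparse l (addEdge G a b ne) (A - v)
sparse-contract {n} G l A v a b ne sparse v∈ va vb S S⊆ with S a in a∈ | S b in b∈
... | false | _ = ≤-trans (degSum-mono (addEdge G a b ne) G S old) (sparse S (λ x e → ∧-left (S⊆ x e)))
  where
  old : ∀ x y → x ∈ S → y ∈ S → Adj (addEdge G a b ne) x y ≡ true → Adj G x y ≡ true
  old x y x∈ y∈ e with addEdge-elim G a b ne x y e
  ... | inj₁ h = h
  ... | inj₂ (inj₁ (refl , _)) = ⊥-elim (true≢false x∈ a∈)
  ... | inj₂ (inj₂ (_ , refl)) = ⊥-elim (true≢false y∈ a∈)
... | true | false = ≤-trans (degSum-mono (addEdge G a b ne) G S old) (sparse S (λ x e → ∧-left (S⊆ x e)))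
  where
  old : ∀ x y → x ∈ S → y ∈ S → Adj (addEdge G a b ne) x y ≡ true → Adj G x y ≡ true
  old x y x∈ y∈ e with addEdge-elim G a b ne x y e
  ... | inj₁ h = h
  ... | inj₂ (inj₁ (_ , refl)) = ⊥-elim (true≢false y∈ b∈)
  ... | inj₂ (inj₂ (refl , _)) = ⊥-elim (true≢false x∈ b∈)
... | true | true = +-cancelʳ-≤ 2 _ _ (begin
    degSum G′ S + 2
      ≡⟨ cong (λ t → degSum G′ S + 2 * t) (#-single v) ⟨
    degSum G′ S + 2 * # (v ==_)
      ≡⟨ cong (degSum G′ S +_) (*-distribˡ-sum 2 (λ x → ⟦ v == x ⟧)) ⟩
    degSum G′ S + sum (λ x → 2 * ⟦ v == x ⟧)
      ≡⟨ ∑-distrib-+ (λ x → ⟦ S x ⟧ * deg G′ S x) (λ x → 2 * ⟦ v == x ⟧) ⟨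
    sum (λ x → ⟦ S x ⟧ * deg G′ S x + 2 * ⟦ v == x ⟧)
      ≤⟨ sum-mono pointwise ⟩
    degSum G S⁺
      ≤⟨ sparse S⁺ S⁺⊆ ⟩
    2 * (# S⁺ + l)
      ≡⟨ cong (λ t → 2 * (t + l)) (#-insert S v v∉S) ⟩
    2 * (suc (# S) + l)
      ≡⟨ arith (# S) l ⟩
    2 * (# S + l) + 2 ∎)
  where
  open ≤-Reasoning
  G′ = addEdge G a b ne
  S⁺ = S ∪ (v ==_)
  arith : ∀ s l → 2 * (suc s + l) ≡ 2 * (s + l) + 2
  arith = solve-∀
  v∉S : v ∉ S
  v∉S with ∈-dec S v
  ... | inj₂ h = h
  ... | inj₁ h = ⊥-elim (proj₂ (∈-remove⁻ A (S⊆ v h)) refl)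
  S⁺⊆ : S⁺ ⊆ A
  S⁺⊆ x e with ∨-elim {S x} e
  ... | inj₁ h = ∧-left (S⊆ x h)
  ... | inj₂ h = subst (_∈ A) (==⇒≡ v x h) v∈
  -- The new neighbour y of x inside S is traded for v.
  trade : ∀ x y → Adj G v x ≡ true → S ∩ Adj G′ x ⊆ (S ∩ Adj G x) ∪ (y ==_) → deg G′ S x ≤ deg G S⁺ x
  trade x y vx sub = begin
    deg G′ S x                        ≤⟨ #-mono (S ∩ Adj G′ x) ((S ∩ Adj G x) ∪ (y ==_)) sub ⟩
    # ((S ∩ Adj G x) ∪ (y ==_))       ≤⟨ #-∪-≤ (S ∩ Adj G x) (y ==_) ⟩
    deg G S x + # (y ==_)             ≡⟨ cong (deg G S x +_) (#-single y) ⟩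
    deg G S x + 1                     ≡⟨ +-comm _ 1 ⟩
    suc (deg G S x)                   ≤⟨ s≤s (#-mono (S ∩ Adj G x) ((S⁺ ∩ Adj G x) - v) λ z e →
                                           ∈-remove (S⁺ ∩ Adj G x) v (∧-intro (∨-left {S z} (∧-left e)) (∧-right {S z} e))
                                             λ { refl → true≢false (∧-left e) v∉S }) ⟩
    suc (# ((S⁺ ∩ Adj G x) - v))      ≡⟨ #-remove (S⁺ ∩ Adj G x) v (∧-intro (∨-right {S v} (==-refl v)) (adj-sym G v x vx)) ⟨
    deg G S⁺ x                        ∎
  compare : ∀ x → Dec (a ≡ x) → Dec (b ≡ x) → deg G′ S x ≤ deg G S⁺ x
  compare x (yes refl) _ = trade a b va λ y e → case addEdge-elim G a b ne a y (∧-right {S y} e) of λ where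
    (inj₁ h) → ∨-left (∧-intro (∧-left {S y} e) h)
    (inj₂ (inj₁ (_ , refl))) → ∨-right {(S ∩ Adj G a) b} (==-refl b)
    (inj₂ (inj₂ (b≡a , _))) → ⊥-elim (ne (≡-sym b≡a))
  compare x (no _) (yes refl) = trade b a vb λ y e → case addEdge-elim G a b ne b y (∧-right {S y} e) of λ where
    (inj₁ h) → ∨-left (∧-intro (∧-left {S y} e) h)
    (inj₂ (inj₁ (a≡b , _))) → ⊥-elim (ne a≡b)
    (inj₂ (inj₂ (_ , refl))) → ∨-right {(S ∩ Adj G b) a} (==-refl a)
  compare x (no a≢x) (no b≢x) = #-mono (S ∩ Adj G′ x) (S⁺ ∩ Adj G x) λ y e →
    case addEdge-elim G a b ne x y (∧-right {S y} e) of λ where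
      (inj₁ h) → ∧-intro (∨-left (∧-left {S y} e)) h
      (inj₂ (inj₁ (a≡x , _))) → ⊥-elim (a≢x a≡x)
      (inj₂ (inj₂ (b≡x , _))) → ⊥-elim (b≢x b≡x)
  pointwise : ∀ x → ⟦ S x ⟧ * deg G′ S x + 2 * ⟦ v == x ⟧ ≤ ⟦ S⁺ x ⟧ * deg G S⁺ x
  pointwise x with S x in x∈ | v ≟ x
  ... | true | yes refl = ⊥-elim (true≢false x∈ v∉S)
  ... | true | no _ = ≤-trans (≤-reflexive (+-identityʳ _)) (*-monoʳ-≤ 1 (compare x (a ≟ x) (b ≟ x)))
  ... | false | no _ = z≤n
  ... | false | yes refl = ≤-trans (#≥2 (S⁺ ∩ Adj G v) a b (∧-intro (∨-left a∈) va) (∧-intro (∨-left b∈) vb) ne)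
    (≤-reflexive (≡-sym (*-identityˡ (deg G S⁺ v))))

-- `t` is the number of edges, and the values of `p` beyond `t` are arbitrary. The two ends may have
-- any degree.
record Suspended {n} (G : Graph n) (A : Sub n) (t : ℕ) (p : ℕ → Fin n) : Set where
  field
    inside : ∀ i → i ≤ t → p i ∈ A
    distinct : ∀ i j → i ≤ t → j ≤ t → p i ≡ p j → i ≡ j
    adjacent : ∀ i → i < t → Adj G (p i) (p (suc i)) ≡ true
    interior : ∀ i → suc i < t → ∀ y → y ∈ A → Adj G (p (suc i)) y ≡ true → y ≡ p i ⊎ y ≡ p (suc (suc i))

Leaf : ∀ {n} → Graph n → Sub n → Sub n
Leaf G A x = A x ∧ (deg G A x ≡ᵇ 1)

leaf-unique : ∀ {n} (G : Graph n) A u → u ∈ Leaf G A →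
  ∃ λ p → (p ∈ A × Adj G u p ≡ true) × ∀ y → y ∈ A → Adj G u y ≡ true → p ≡ y
leaf-unique G A u u∈ with ≡ᵇ⇒≡ (deg G A u) 1 (subst IsTrue (≡-sym (∧-right {A u} u∈)) _)
... | d≡1 with #-pos (A ∩ Adj G u) (≤-reflexive (≡-sym d≡1))
... | p , p∈ = p , (∧-left p∈ , ∧-right {A p} p∈) , unique
  where
  unique : ∀ y → y ∈ A → Adj G u y ≡ true → p ≡ y
  unique y y∈ e with p ≟ y
  ... | yes h = h
  ... | no ne = ⊥-elim (<-irrefl (≡-sym d≡1) (#≥2 (A ∩ Adj G u) p y p∈ (∧-intro y∈ e) ne))

-- Distance layers around the vertices of degree other than 2

module Layers {n} (G : Graph n) (l : ℕ) (A : Sub n) (conn : Conn G A) (sparse : Sparse l G A) (large : 2 ≤ # A) where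

  -- An isolated vertex would form a closed set by itself, against connectivity.
  deg-pos : ∀ x → x ∈ A → 0 < deg G A x
  deg-pos x x∈ with 0 <? deg G A x
  ... | yes h = h
  ... | no h = ⊥-elim (<⇒≱ large (≤-trans (#-mono A (x ==_) (conn (x ==_) x (==-refl x)
      (λ y e → subst (_∈ A) (==⇒≡ x y e) x∈) closed)) (≤-reflexive (#-single x))))
    where
    closed : ∀ u v → u ∈ (x ==_) → v ∈ A → Adj G u v ≡ true → v ∈ (x ==_)
    closed u v u∈ v∈ e with ==⇒≡ x u u∈
    ... | refl = ⊥-elim (h (≤-trans (s≤s z≤n) (≤-reflexive (≡-sym (#-remove (A ∩ Adj G x) v (∧-intro v∈ e))))))

  root : Fin n
  root = proj₁ (#-pos A (≤-trans (s≤s z≤n) large))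

  root∈ : root ∈ A
  root∈ = proj₂ (#-pos A (≤-trans (s≤s z≤n) large))

  -- The `root` is added because a cycle has no vertex of degree other than 2 to start from; it
  -- accounts for the last summand in `darts-≤`.
  Branch : Sub n
  Branch x = A x ∧ (not (deg G A x ≡ᵇ 2) ∨ root == x)

  -- The number of edge ends at `Branch`; it bounds the size of every layer.
  darts : ℕ
  darts = sum λ x → ⟦ Branch x ⟧ * deg G A x

  -- A vertex of degree d ≥ 1 satisfies d * [d ≠ 2] + 6 ≤ 3 * d + 4 * [d = 1].
  darts-≤ : darts ≤ 6 * l + 4 * # (Leaf G A) + 2
  darts-≤ = +-cancelʳ-≤ (6 * # A) _ _ (begin
    darts + 6 * # A
      ≡⟨ cong (darts +_) (*-distribˡ-sum 6 (λ x → ⟦ A x ⟧)) ⟩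
    darts + sum (λ x → 6 * ⟦ A x ⟧)
      ≡⟨ ∑-distrib-+ (λ x → ⟦ Branch x ⟧ * deg G A x) (λ x → 6 * ⟦ A x ⟧) ⟨
    sum (λ x → ⟦ Branch x ⟧ * deg G A x + 6 * ⟦ A x ⟧)
      ≤⟨ sum-mono pointwise ⟩
    sum (λ x → 3 * (⟦ A x ⟧ * deg G A x) + (4 * ⟦ Leaf G A x ⟧ + 2 * ⟦ root == x ⟧))
      ≡⟨ ∑-distrib-+ (λ x → 3 * (⟦ A x ⟧ * deg G A x)) (λ x → 4 * ⟦ Leaf G A x ⟧ + 2 * ⟦ root == x ⟧) ⟩
    sum (λ x → 3 * (⟦ A x ⟧ * deg G A x)) + sum (λ x → 4 * ⟦ Leaf G A x ⟧ + 2 * ⟦ root == x ⟧)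
      ≡⟨ cong₂ _+_ (≡-sym (*-distribˡ-sum 3 (λ x → ⟦ A x ⟧ * deg G A x)))
           (∑-distrib-+ (λ x → 4 * ⟦ Leaf G A x ⟧) (λ x → 2 * ⟦ root == x ⟧)) ⟩
    3 * degSum G A + (sum (λ x → 4 * ⟦ Leaf G A x ⟧) + sum (λ x → 2 * ⟦ root == x ⟧))
      ≡⟨ cong (3 * degSum G A +_) (cong₂ _+_ (≡-sym (*-distribˡ-sum 4 (λ x → ⟦ Leaf G A x ⟧)))
           (trans (≡-sym (*-distribˡ-sum 2 (λ x → ⟦ root == x ⟧))) (cong (2 *_) (#-single root)))) ⟩
    3 * degSum G A + (4 * # (Leaf G A) + 2)
      ≤⟨ +-monoˡ-≤ _ (*-monoʳ-≤ 3 (sparse A λ _ e → e)) ⟩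
    3 * (2 * (# A + l)) + (4 * # (Leaf G A) + 2)
      ≡⟨ arith (# A) l (# (Leaf G A)) ⟩
    6 * l + 4 * # (Leaf G A) + 2 + 6 * # A ∎)
    where
    open ≤-Reasoning
    arith : ∀ a l ℓ → 3 * (2 * (a + l)) + (4 * ℓ + 2) ≡ 6 * l + 4 * ℓ + 2 + 6 * a
    arith = solve-∀
    big : ∀ d → 1 * (3 + d) + 6 + (2 * d) ≡ 3 * (1 * (3 + d))
    big = solve-∀
    by-degree : ∀ d r → 0 < d → ⟦ not (d ≡ᵇ 2) ∨ r ⟧ * d + 6 * 1 ≤ 3 * (1 * d) + (4 * ⟦ d ≡ᵇ 1 ⟧ + 2 * ⟦ r ⟧)
    by-degree 1 r _ = +-monoʳ-≤ 7 z≤n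
    by-degree 2 true _ = ≤-refl
    by-degree 2 false _ = ≤-refl
    by-degree (suc (suc (suc d))) r _ = ≤-trans (≤-trans (m≤m+n _ (2 * d)) (≤-reflexive (big d))) (m≤m+n _ _)
    pointwise : ∀ x → ⟦ Branch x ⟧ * deg G A x + 6 * ⟦ A x ⟧ ≤ 3 * (⟦ A x ⟧ * deg G A x) + (4 * ⟦ Leaf G A x ⟧ + 2 * ⟦ root == x ⟧)
    pointwise x with A x in x∈
    ... | false = z≤n
    ... | true = by-degree (deg G A x) (root == x) (deg-pos x x∈)

  -- The vertices at distance at most `i` from `Branch`; those of `Layer i` are at distance exactly
  -- `i`.
  Reach : ℕ → Sub n
  Reach zero = Branch
  Reach (suc i) x = Reach i x ∨ (A x ∧ exists (Reach i ∩ Adj G x))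

  Layer : ℕ → Sub n
  Layer zero = Branch
  Layer (suc i) = Reach (suc i) ∖ Reach i

  reach⊆A : ∀ i → Reach i ⊆ A
  reach⊆A zero x e = ∧-left e
  reach⊆A (suc i) x e with ∨-elim {Reach i x} e
  ... | inj₁ h = reach⊆A i x h
  ... | inj₂ h = ∧-left h

  layer⊆reach : ∀ i → Layer i ⊆ Reach i
  layer⊆reach zero x e = e
  layer⊆reach (suc i) x e = ∧-left e

  reach-step : ∀ i x y → x ∈ Reach i → y ∈ A → Adj G x y ≡ true → y ∈ Reach (suc i)
  reach-step i x y x∈ y∈ e = ∨-right {Reach i y} (∧-intro y∈ (exists-intro (Reach i ∩ Adj G y) x (∧-intro x∈ (adj-sym G x y e))))

  reach-mono : ∀ {i j} → i ≤ j → Reach i ⊆ Reach j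
  reach-mono {i} {j} i≤j x e with ≤⇒≤′ i≤j
  ... | i≤′j = go i≤′j
    where
    go : ∀ {j} → i ≤′ j → x ∈ Reach j
    go ≤′-refl = e
    go (≤′-step h) = ∨-left (go h)

  layer-back : ∀ i x → x ∈ Layer (suc i) → ∃ λ y → y ∈ Layer i × Adj G x y ≡ true
  layer-back i x x∈ with ∨-elim {Reach i x} (∧-left x∈)
  ... | inj₁ h = ⊥-elim (true≢false h (not-elim (∧-right {Reach (suc i) x} x∈)))
  ... | inj₂ h with exists-elim (Reach i ∩ Adj G x) (∧-right {A x} h)
  ... | y , y∈ = y , exact i (∧-left y∈) (not-elim (∧-right {Reach (suc i) x} x∈)) , ∧-right {Reach i y} y∈
    where
    exact : ∀ i → y ∈ Reach i → x ∉ Reach i → y ∈ Layer i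
    exact zero h _ = h
    exact (suc m) h x∉ with ∈-dec (Reach m) y
    ... | inj₂ y∉ = ∧-intro h (not-intro y∉)
    ... | inj₁ y∈′ = ⊥-elim (true≢false (reach-step m y x y∈′ (reach⊆A (suc i) x (∧-left x∈)) (adj-sym G x y (∧-right {Reach i y} y∈))) x∉)

  layers-disjoint : ∀ i j x → x ∈ Layer i → x ∈ Layer j → ¬ i < j
  layers-disjoint i (suc j) x xi xj (s≤s i≤j) =
    true≢false (reach-mono i≤j x (layer⊆reach i x xi)) (not-elim (∧-right {Reach (suc j) x} xj))

  unbranched : ∀ i x → x ∈ Layer (suc i) → deg G A x ≡ 2
  unbranched i x x∈ with (deg G A x ≡ᵇ 2) in eq
  ... | true = ≡ᵇ⇒≡ (deg G A x) 2 (subst IsTrue (≡-sym eq) _)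
  ... | false = ⊥-elim (layers-disjoint 0 (suc i) x
    (∧-intro (reach⊆A (suc i) x (layer⊆reach (suc i) x x∈)) (∨-left (not-intro eq))) x∈ (s≤s z≤n))

  -- A vertex of a layer with positive index has degree 2 and a neighbour one layer closer, so it
  -- has at most one neighbour one layer farther. Hence sizes do not increase from the first layer
  -- on.
  layer-≤ : ∀ i → # (Layer (suc i)) ≤ darts
  layer-≤ zero = ≤-trans (#-mono (Layer 1) (bind Branch (λ y → A ∩ Adj G y)) sub) (#-bind Branch (λ y → A ∩ Adj G y))
    where
    sub : Layer 1 ⊆ bind Branch (λ y → A ∩ Adj G y)
    sub x x∈ with layer-back 0 x x∈
    ... | y , y∈ , e = exists-intro (λ y → Branch y ∧ (A ∩ Adj G y) x) y
      (∧-intro y∈ (∧-intro (reach⊆A 1 x (∧-left x∈)) (adj-sym G x y e)))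
  layer-≤ (suc i) = ≤-trans (≤-trans (#-mono (Layer (suc (suc i))) (bind (Layer (suc i)) next) sub)
    (≤-trans (#-bind (Layer (suc i)) next)
      (#-weighted-≤ (Layer (suc i)) (λ y → # (next y)) 1 λ y y∈ → #≤1 (next y) (next-unique y y∈))))
    (≤-trans (≤-reflexive (*-identityʳ _)) (layer-≤ i))
    where
    next : Fin n → Sub n
    next y = Layer (suc (suc i)) ∩ Adj G y
    sub : Layer (suc (suc i)) ⊆ bind (Layer (suc i)) next
    sub x x∈ with layer-back (suc i) x x∈
    ... | y , y∈ , e = exists-intro (λ y → Layer (suc i) y ∧ next y x) y (∧-intro y∈ (∧-intro x∈ (adj-sym G x y e)))
    inA : ∀ j x → x ∈ Layer j → x ∈ A
    inA j x e = reach⊆A j x (layer⊆reach j x e)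
    next-unique : ∀ y → y ∈ Layer (suc i) → ∀ w w′ → w ∈ next y → w′ ∈ next y → w ≡ w′
    next-unique y y∈ w w′ w∈ w′∈ with w ≟ w′ | layer-back i y y∈
    ... | yes h | _ = h
    ... | no ne | z , z∈ , e = ⊥-elim (<-irrefl (≡-sym (unbranched i y y∈)) (#≥3 (A ∩ Adj G y) z w w′
      (∧-intro (inA i z z∈) e) (nb w w∈) (nb w′ w′∈) (apart w w∈) (apart w′ w′∈) ne))
      where
      nb : ∀ w → w ∈ next y → w ∈ A ∩ Adj G y
      nb w w∈ = ∧-intro (inA (suc (suc i)) w (∧-left w∈)) (∧-right {Layer (suc (suc i)) w} w∈)
      apart : ∀ w → w ∈ next y → ¬ z ≡ w
      apart w w∈ refl = layers-disjoint i (suc (suc i)) z z∈ (∧-left w∈) (s≤s (n≤1+n i))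

  reach-≤ : ∀ i → # (Reach i) ≤ suc i * darts
  reach-≤ zero = ≤-trans (sum-mono pointwise) (≤-reflexive (≡-sym (+-identityʳ darts)))
    where
    pointwise : ∀ x → ⟦ Branch x ⟧ ≤ ⟦ Branch x ⟧ * deg G A x
    pointwise x with Branch x in eq
    ... | false = z≤n
    ... | true = ≤-trans (deg-pos x (∧-left eq)) (≤-reflexive (≡-sym (*-identityˡ (deg G A x))))
  reach-≤ (suc i) = ≤-trans (#-∖-≤ (Reach (suc i)) (Reach i))
    (≤-trans (+-mono-≤ (reach-≤ i) (layer-≤ i)) (≤-reflexive (+-comm (suc i * darts) darts)))

  -- With the next layer empty, `Reach i` is closed under adjacency, and it contains the root.
  exhausted : ∀ i → (∀ x → x ∉ Layer (suc i)) → A ⊆ Reach i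
  exhausted i none = conn (Reach i) root
    (reach-mono {0} {i} z≤n root (∧-intro root∈ (∨-right {not (deg G A root ≡ᵇ 2)} (==-refl root)))) (reach⊆A i) closed
    where
    closed : ∀ u v → u ∈ Reach i → v ∈ A → Adj G u v ≡ true → v ∈ Reach i
    closed u v u∈ v∈ e with ∈-dec (Reach i) v
    ... | inj₁ h = h
    ... | inj₂ v∉ = ⊥-elim (true≢false (∧-intro (reach-step i u v u∈ v∈ e) (not-intro v∉)) (none v))

  -- Walking towards `Branch` takes one vertex from each layer. Disjointness of the layers will make
  -- the path simple, and positive layer indices give its interior vertices degree 2.
  descend : ∀ i x → x ∈ Layer i → ∃ λ (p : ℕ → Fin n) → p 0 ≡ x × (∀ j → j ≤ i → p j ∈ Layer (i ∸ j)) ×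
    (∀ j → j < i → Adj G (p j) (p (suc j)) ≡ true)
  descend zero x x∈ = (λ _ → x) , refl , (λ { zero _ → x∈ }) , λ j ()
  descend (suc i) x x∈ with layer-back i x x∈
  ... | y , y∈ , e with descend i y y∈
  ... | p , p0 , lay , adj = q , refl , lay′ , adj′
    where
    q : ℕ → Fin n
    q zero = x
    q (suc j) = p j
    lay′ : ∀ j → j ≤ suc i → q j ∈ Layer (suc i ∸ j)
    lay′ zero _ = x∈
    lay′ (suc j) (s≤s h) = lay j h
    adj′ : ∀ j → j < suc i → Adj G (q j) (q (suc j)) ≡ true
    adj′ zero _ = subst (λ z → Adj G x z ≡ true) (≡-sym p0) e
    adj′ (suc j) (s≤s h) = adj j h

  suspended : ∀ t x → x ∈ Layer t → ∃ λ p → Suspended G A t p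
  suspended t x x∈ with descend t x x∈
  ... | p , _ , lay , adj = p , record { inside = ins ; distinct = dist ; adjacent = adj ; interior = int }
    where
    ins : ∀ i → i ≤ t → p i ∈ A
    ins i h = reach⊆A (t ∸ i) (p i) (layer⊆reach (t ∸ i) (p i) (lay i h))
    dist : ∀ i j → i ≤ t → j ≤ t → p i ≡ p j → i ≡ j
    dist i j hi hj e = ∸-cancelˡ-≡ hi hj (≤-antisym
      (≮⇒≥ (layers-disjoint (t ∸ j) (t ∸ i) (p i) (subst (_∈ Layer (t ∸ j)) (≡-sym e) (lay j hj)) (lay i hi)))
      (≮⇒≥ (layers-disjoint (t ∸ i) (t ∸ j) (p i) (lay i hi) (subst (_∈ Layer (t ∸ j)) (≡-sym e) (lay j hj)))))
    deg-two : ∀ i → suc i < t → deg G A (p (suc i)) ≡ 2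
    deg-two i h with t ∸ suc i | lay (suc i) (<⇒≤ h) | m<n⇒0<n∸m h
    ... | suc m | z | _ = unbranched m (p (suc i)) z
    int : ∀ i → suc i < t → ∀ y → y ∈ A → Adj G (p (suc i)) y ≡ true → y ≡ p i ⊎ y ≡ p (suc (suc i))
    int i h y y∈ e with y ≟ p i | y ≟ p (suc (suc i))
    ... | yes q | _ = inj₁ q
    ... | no _ | yes q = inj₂ q
    ... | no q | no q′ = ⊥-elim (<-irrefl (≡-sym (deg-two i h)) (#≥3 (A ∩ Adj G (p (suc i))) y (p i) (p (suc (suc i)))
      (∧-intro y∈ e) (∧-intro (ins i i≤t) (adj-sym G (p i) (p (suc i)) (adj i (<-trans (n<1+n i) h)))) (∧-intro (ins _ h) (adj (suc i) h)) q q′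
      λ eq → <-irrefl (dist i (suc (suc i)) i≤t h eq) (s≤s (n≤1+n i))))
      where
      i≤t : i ≤ t
      i≤t = ≤-trans (n≤1+n i) (<⇒≤ h)

  -- A vertex at distance `suc q` starts the path. If there is none, `A` consists of `suc q` layers
  -- with at most `darts` vertices each.
  dichotomy : ∀ q → (∃ λ p → Suspended G A (suc q) p) ⊎ # A ≤ suc q * (6 * l + 4 * # (Leaf G A) + 2)
  dichotomy q with 0 <? # (Layer (suc q))
  ... | yes h with #-pos (Layer (suc q)) h
  ... | x , x∈ = inj₁ (suspended (suc q) x x∈)
  dichotomy q | no h = inj₂ (≤-trans (#-mono A (Reach q) (exhausted q none))
    (≤-trans (reach-≤ q) (*-monoʳ-≤ (suc q) darts-≤)))
    where
    none : ∀ x → x ∉ Layer (suc q)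
    none x with ∈-dec (Layer (suc q)) x
    ... | inj₂ x∉ = x∉
    ... | inj₁ x∈ = ⊥-elim (h (≤-trans (s≤s z≤n) (≤-reflexive (≡-sym (#-remove (Layer (suc q)) x x∈)))))

-- Lengthening a red suspended path

-- `w` gets position `suc c`, between the entries `c` and `suc c` of `y`.
insert : ∀ {X : Set} → ℕ → X → (ℕ → X) → ℕ → X
insert c w y zero = y 0
insert zero w y (suc zero) = w
insert zero w y (suc (suc i)) = y (suc i)
insert (suc c) w y (suc i) = insert c w (y ∘ suc) i

insert-value : ∀ {X : Set} c (w : X) y s → c < s → ∀ i → i ≤ suc s → insert c w y i ≡ w ⊎ ∃ λ j → j ≤ s × insert c w y i ≡ y j
insert-value c w y s _ zero _ = inj₂ (0 , z≤n , refl)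
insert-value zero w y s _ (suc zero) _ = inj₁ refl
insert-value zero w y s _ (suc (suc i)) (s≤s h) = inj₂ (suc i , h , refl)
insert-value (suc c) w y (suc s) (s≤s c<s) (suc i) (s≤s h) with insert-value c w (y ∘ suc) s c<s i h
... | inj₁ e = inj₁ e
... | inj₂ (j , j≤ , e) = inj₂ (suc j , s≤s j≤ , e)

insert-last : ∀ {X : Set} c (w : X) y s → c < s → insert c w y (suc s) ≡ y s
insert-last zero w y (suc s) _ = refl
insert-last (suc c) w y (suc s) (s≤s h) = insert-last c w (y ∘ suc) s h

insert-injective : ∀ {X : Set} c (w : X) y s → c < s →
  (∀ i j → i ≤ s → j ≤ s → y i ≡ y j → i ≡ j) → (∀ j → j ≤ s → ¬ w ≡ y j) →
  ∀ i j → i ≤ suc s → j ≤ suc s → insert c w y i ≡ insert c w y j → i ≡ j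
insert-injective c w y s c<s inj fresh zero zero _ _ _ = refl
insert-injective zero w y s c<s inj fresh zero (suc zero) _ _ e = ⊥-elim (fresh 0 z≤n (≡-sym e))
insert-injective zero w y s c<s inj fresh zero (suc (suc j)) _ (s≤s hj) e = case inj 0 (suc j) z≤n hj e of λ ()
insert-injective zero w y s c<s inj fresh (suc zero) zero _ _ e = ⊥-elim (fresh 0 z≤n e)
insert-injective zero w y s c<s inj fresh (suc (suc i)) zero (s≤s hi) _ e = case inj (suc i) 0 hi z≤n e of λ ()
insert-injective zero w y s c<s inj fresh (suc zero) (suc zero) _ _ _ = refl
insert-injective zero w y s c<s inj fresh (suc zero) (suc (suc j)) _ (s≤s hj) e = ⊥-elim (fresh (suc j) hj e)
insert-injective zero w y s c<s inj fresh (suc (suc i)) (suc zero) (s≤s hi) _ e = ⊥-elim (fresh (suc i) hi (≡-sym e))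
insert-injective zero w y s c<s inj fresh (suc (suc i)) (suc (suc j)) (s≤s hi) (s≤s hj) e = cong suc (inj (suc i) (suc j) hi hj e)
insert-injective (suc c) w y (suc s) (s≤s c<s) inj fresh zero (suc j) _ (s≤s hj) e with insert-value c w (y ∘ suc) s c<s j hj
... | inj₁ q = ⊥-elim (fresh 0 z≤n (≡-sym (trans e q)))
... | inj₂ (m , m≤ , q) = case inj 0 (suc m) z≤n (s≤s m≤) (trans e q) of λ ()
insert-injective (suc c) w y (suc s) (s≤s c<s) inj fresh (suc i) zero (s≤s hi) _ e with insert-value c w (y ∘ suc) s c<s i hi
... | inj₁ q = ⊥-elim (fresh 0 z≤n (trans (≡-sym q) e))
... | inj₂ (m , m≤ , q) = case inj 0 (suc m) z≤n (s≤s m≤) (trans (≡-sym e) q) of λ ()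
insert-injective (suc c) w y (suc s) (s≤s c<s) inj fresh (suc i) (suc j) (s≤s hi) (s≤s hj) e =
  cong suc (insert-injective c w (y ∘ suc) s c<s (λ i j hi hj e → suc-injective (inj (suc i) (suc j) (s≤s hi) (s≤s hj) e))
    (λ j hj → fresh (suc j) (s≤s hj)) i j hi hj e)

-- The link from `y c` to `y (suc c)` is the one that `w` replaces. After a reversal it is the
-- broken one, so the hypothesis exempts it.
insert-chain : ∀ {X : Set} (_~_ : X → X → Set) c w y s → c < s →
  (∀ i → i < s → ¬ i ≡ c → y i ~ y (suc i)) → y c ~ w → w ~ y (suc c) →
  ∀ i → i < suc s → insert c w y i ~ insert c w y (suc i)
insert-chain _~_ zero w y s c<s chain l r zero _ = l
insert-chain _~_ zero w y s c<s chain l r (suc zero) _ = r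
insert-chain _~_ zero w y s c<s chain l r (suc (suc i)) (s≤s h) = chain (suc i) h λ ()
insert-chain _~_ (suc c) w y (suc s) c<s chain l r zero _ = chain 0 (s≤s z≤n) λ ()
insert-chain _~_ (suc c) w y (suc s) (s≤s c<s) chain l r (suc i) (s≤s h) =
  insert-chain _~_ c w (y ∘ suc) s c<s (λ i h ne → chain (suc i) (s≤s h) (ne ∘ suc-injective)) l r i h

-- The indices from `suc a` to `b` are turned around, which gives the order `z 0 .. z a`,
-- `z b .. z (suc a)`, `z (suc b) ..`. With `w` inserted after `z a` this is the path rotation
-- behind `successors-blue`.
module Reversal (a b : ℕ) (a<b : a < b) where

  reverse : ℕ → ℕ
  reverse i with a <? i | i ≤? b
  ... | yes _ | yes _ = suc (a + b) ∸ i
  ... | yes _ | no _ = i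
  ... | no _ | _ = i

  -- The sum `r + i` replaces the truncated subtraction in `reverse`.
  data View (i : ℕ) : ℕ → Set where
    within : ∀ {r} → a < i → i ≤ b → r + i ≡ suc (a + b) → View i r
    below : i ≤ a → View i i
    above : b < i → View i i

  view : ∀ i → View i (reverse i)
  view i with a <? i | i ≤? b
  ... | yes p | yes q = within p q (m∸n+n≡m (≤-trans q (≤-trans (m≤n+m b a) (n≤1+n _))))
  ... | yes _ | no q = above (≰⇒> q)
  ... | no p | _ = below (≮⇒≥ p)

  within-≤ : ∀ {i r} → a < i → r + i ≡ suc (a + b) → r ≤ b
  within-≤ {i} {r} a<i e = +-cancelˡ-≤ (suc a) r b (≤-trans (≤-reflexive (+-comm (suc a) r)) (≤-trans (+-monoʳ-≤ r a<i) (≤-reflexive e)))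

  within-> : ∀ {i r} → i ≤ b → r + i ≡ suc (a + b) → a < r
  within-> {i} {r} i≤b e = +-cancelʳ-≤ b (suc a) r (≤-trans (≤-reflexive (≡-sym e)) (+-monoʳ-≤ r i≤b))

  reverse-≤ : ∀ s → b ≤ s → ∀ i → i ≤ s → reverse i ≤ s
  reverse-≤ s b≤s i i≤s with reverse i | view i
  ... | r | within p q e = ≤-trans (within-≤ p e) b≤s
  ... | _ | below _ = i≤s
  ... | _ | above _ = i≤s

  reverse-injective : ∀ i j → reverse i ≡ reverse j → i ≡ j
  reverse-injective i j e with reverse i | view i | reverse j | view j
  reverse-injective i j refl | r | within _ _ p | _ | within _ _ q = +-cancelˡ-≡ r i j (trans p (≡-sym q))
  reverse-injective i j refl | r | within p q e | _ | below h = ⊥-elim (<⇒≱ (within-> q e) h)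
  reverse-injective i j refl | r | within p q e | _ | above h = ⊥-elim (<⇒≱ h (within-≤ p e))
  reverse-injective i j refl | _ | below h | _ | within p q e = ⊥-elim (<⇒≱ (within-> q e) h)
  reverse-injective i j refl | _ | above h | _ | within p q e = ⊥-elim (<⇒≱ h (within-≤ p e))
  reverse-injective i j refl | _ | below _ | _ | below _ = refl
  reverse-injective i j refl | _ | below _ | _ | above _ = refl
  reverse-injective i j refl | _ | above _ | _ | below _ = refl
  reverse-injective i j refl | _ | above _ | _ | above _ = refl

  reverse-below : ∀ i → i ≤ a → reverse i ≡ i
  reverse-below i h with reverse i | view i
  ... | _ | within p _ _ = ⊥-elim (<⇒≱ p h)
  ... | _ | below _ = refl
  ... | _ | above _ = refl

  reverse-above : ∀ i → b < i → reverse i ≡ i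
  reverse-above i h with reverse i | view i
  ... | _ | within _ q _ = ⊥-elim (<⇒≱ h q)
  ... | _ | below _ = refl
  ... | _ | above _ = refl

  reverse-start : reverse (suc a) ≡ b
  reverse-start with reverse (suc a) | view (suc a)
  ... | r | within _ _ e = +-cancelʳ-≡ (suc a) r b (trans e (trans (cong suc (+-comm a b)) (≡-sym (+-suc b a))))
  ... | _ | below h = ⊥-elim (<-irrefl refl h)
  ... | _ | above h = ⊥-elim (<⇒≱ h a<b)

  -- Links within the segment are old links traversed backwards, and the link after it is `joint`.
  -- The link at `a` is broken and is left to the inserted vertex.
  reverse-chain : ∀ {X : Set} (_~_ : X → X → Set) → (∀ {x y} → x ~ y → y ~ x) → (z : ℕ → X) → ∀ s → b < s →
    (∀ i → i < s → z i ~ z (suc i)) → z (suc a) ~ z (suc b) →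
    ∀ i → i < s → ¬ i ≡ a → z (reverse i) ~ z (reverse (suc i))
  reverse-chain _~_ flip z s b<s chain joint i i<s i≢a with reverse i | view i | reverse (suc i) | view (suc i)
  ... | r | within p q e | r′ | within p′ q′ e′ with suc-injective {r} {suc r′}
          (+-cancelʳ-≡ i (suc r) (suc (suc r′)) (trans (cong suc e) (cong suc (trans (≡-sym e′) (+-suc r′ i)))))
  ... | refl = flip (chain r′ (≤-trans (within-≤ p e) (<⇒≤ b<s)))
  reverse-chain _~_ flip z s b<s chain joint i i<s i≢a | r | within p q e | _ | below h = ⊥-elim (<-asym p h)
  reverse-chain _~_ flip z s b<s chain joint i i<s i≢a | r | within p q e | _ | above (s≤s h)
    with ≤-antisym q h
  ... | refl with +-cancelʳ-≡ i r (suc a) e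
  ... | refl = joint
  reverse-chain _~_ flip z s b<s chain joint i i<s i≢a | _ | below h | _ | within (s≤s p) q e = ⊥-elim (i≢a (≤-antisym h p))
  reverse-chain _~_ flip z s b<s chain joint i i<s i≢a | _ | above h | _ | within p q e = ⊥-elim (<-asym h q)
  reverse-chain _~_ flip z s b<s chain joint i i<s i≢a | _ | below _ | _ | below _ = chain i i<s
  reverse-chain _~_ flip z s b<s chain joint i i<s i≢a | _ | below _ | _ | above _ = chain i i<s
  reverse-chain _~_ flip z s b<s chain joint i i<s i≢a | _ | above _ | _ | below _ = chain i i<s
  reverse-chain _~_ flip z s b<s chain joint i i<s i≢a | _ | above _ | _ | above _ = chain i i<s

-- A blue `B_k` is a blue edge with `k` common blue neighbours; this is its absence in the form in
-- which it is counted.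
NoBook : ∀ {N} → Colouring N → ℕ → Set
NoBook χ k = ∀ u v → v ∈ B u → # (B u ∩ B v) < k
  where open Colours χ

module Lengthen {N} (χ : Colouring N) (k : ℕ) (no-book : NoBook χ k) {n} (G : Graph n) (A : Sub n)
  (r : ℕ) (p : ℕ → Fin n) (susp : Suspended G A (suc (suc r)) p) (long : 3 * k ≤ suc r)
  (ends : ¬ p 0 ≡ p 2) (f : Fin n → Fin N) where

  open Colours χ
  open Suspended susp

  s t : ℕ
  s = suc r
  t = suc s

  A⁻ : Sub n
  A⁻ = A - p 1

  module _ (emb-f : Emb (addEdge G (p 0) (p 2) ends) A⁻ f) where

    -- Position 1 belongs to the removed vertex. Thus `z 0`, ..., `z s` is the red image of the
    -- contracted path `p 0`, `p 2`, ..., `p t`.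
    skip : ℕ → ℕ
    skip zero = 0
    skip (suc i) = suc (suc i)

    z : ℕ → Fin N
    z i = f (p (skip i))

    skip-≤ : ∀ i → i ≤ s → skip i ≤ t
    skip-≤ zero _ = z≤n
    skip-≤ (suc i) h = s≤s h

    skip-injective : ∀ i j → skip i ≡ skip j → i ≡ j
    skip-injective zero zero _ = refl
    skip-injective (suc i) (suc j) e = suc-injective e

    skip-≢1 : ∀ i → ¬ 1 ≡ skip i
    skip-≢1 zero ()
    skip-≢1 (suc i) ()

    skip∈ : ∀ i → i ≤ s → p (skip i) ∈ A⁻
    skip∈ i h = ∈-remove A (p 1) (inside (skip i) (skip-≤ i h)) λ e → skip-≢1 i (distinct 1 (skip i) (s≤s z≤n) (skip-≤ i h) e)

    z-injective : ∀ i j → i ≤ s → j ≤ s → z i ≡ z j → i ≡ j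
    z-injective i j hi hj e = skip-injective i j (distinct (skip i) (skip j) (skip-≤ i hi) (skip-≤ j hj)
      (injective emb-f (p (skip i)) (p (skip j)) (skip∈ i hi) (skip∈ j hj) e))

    z-red : ∀ i → i < s → z (suc i) ∈ R (z i)
    z-red zero h = edges emb-f (p 0) (p 2) (skip∈ 0 z≤n) (skip∈ 1 h) (addEdge-new G (p 0) (p 2) ends)
    z-red (suc i) h = edges emb-f (p (skip (suc i))) (p (skip (suc (suc i)))) (skip∈ (suc i) (<⇒≤ h)) (skip∈ (suc (suc i)) h)
      (∨-left (adjacent (suc (suc i)) (s≤s h)))

    Outside : Sub N
    Outside w = not (image f A⁻ w)

    outside-≢ : ∀ w x → w ∈ Outside → x ∈ A⁻ → ¬ f x ≡ w
    outside-≢ w x w∈ x∈ = ∉-image f A⁻ (not-elim w∈) x∈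

    module Reroute (y : ℕ → Fin N) (y-injective : ∀ i j → i ≤ t → j ≤ t → y i ≡ y j → i ≡ j)
      (first : y 0 ≡ z 0) (last : y t ≡ z s)
      (values : ∀ i → i ≤ t → y i ∈ Outside ⊎ ∃ λ j → j ≤ s × y i ≡ z j)
      (y-red : ∀ i → i < t → y (suc i) ∈ R (y i)) where

      Interior : Fin n → Set
      Interior x = ∃ λ (i : Fin s) → p (suc (toℕ i)) ≡ x

      value : ∀ x → Dec (Interior x) → Fin N
      value x (yes (i , _)) = y (suc (toℕ i))
      value x (no _) = f x

      interior? : ∀ x → Dec (Interior x)
      interior? x = any? λ i → p (suc (toℕ i)) ≟ x

      g : Fin n → Fin N
      g x = value x (interior? x)

      data View (x : Fin n) : Fin N → Set where
        inner : ∀ i → i < s → p (suc i) ≡ x → View x (y (suc i))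
        outer : (∀ i → i < s → ¬ p (suc i) ≡ x) → View x (f x)

      view : ∀ x → View x (g x)
      view x with interior? x
      ... | yes (i , e) = inner (toℕ i) (toℕ<n i) e
      ... | no none = outer λ i i<s e → none (fromℕ< i<s , trans (cong (p ∘ suc) (toℕ-fromℕ< i<s)) e)

      on-path : ∀ i → i ≤ t → g (p i) ≡ y i
      on-path i i≤t with g (p i) | view (p i)
      ... | _ | inner j j<s e = cong y (distinct (suc j) i (≤-trans j<s (n≤1+n s)) i≤t e)
      on-path zero i≤t | _ | outer none = ≡-sym first
      on-path (suc i) (s≤s i≤s) | _ | outer none with m≤n⇒m<n∨m≡n i≤s
      ... | inj₁ i<s = ⊥-elim (none i i<s refl)
      ... | inj₂ refl = ≡-sym last

      outer∈ : ∀ x → x ∈ A → (∀ i → i < s → ¬ p (suc i) ≡ x) → x ∈ A⁻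
      outer∈ x x∈ none = ∈-remove A (p 1) x∈ (none 0 (s≤s z≤n))

      -- A value of `y` taken from the old path is either one of its ends, which injectivity of `y`
      -- excludes, or the image of an interior vertex, which injectivity of `f` excludes.
      separate : ∀ i x → i < s → x ∈ A → (∀ i → i < s → ¬ p (suc i) ≡ x) → ¬ y (suc i) ≡ f x
      separate i x i<s x∈ none e with values (suc i) (≤-trans i<s (n≤1+n s))
      ... | inj₁ out = outside-≢ (y (suc i)) x out (outer∈ x x∈ none) (≡-sym e)
      ... | inj₂ (zero , _ , q) = case y-injective (suc i) 0 (≤-trans i<s (n≤1+n s)) z≤n (trans q (≡-sym first)) of λ ()
      ... | inj₂ (suc j , j<s , q) with m≤n⇒m<n∨m≡n j<s
      ... | inj₁ lt = none (suc j) lt (injective emb-f (p (suc (suc j))) x (skip∈ (suc j) j<s) (outer∈ x x∈ none) (trans (≡-sym q) e))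
      ... | inj₂ refl = <-irrefl (suc-injective (y-injective (suc i) t (≤-trans i<s (n≤1+n s)) ≤-refl (trans q (≡-sym last)))) i<s

      g-injective : ∀ x x′ → x ∈ A → x′ ∈ A → g x ≡ g x′ → x ≡ x′
      g-injective x x′ x∈ x′∈ e with g x | view x | g x′ | view x′
      ... | _ | inner i i<s q | _ | inner j j<s q′ =
        trans (≡-sym q) (trans (cong p (y-injective (suc i) (suc j) (≤-trans i<s (n≤1+n s)) (≤-trans j<s (n≤1+n s)) e)) q′)
      ... | _ | inner i i<s q | _ | outer none = ⊥-elim (separate i x′ i<s x′∈ none e)
      ... | _ | outer none | _ | inner j j<s q′ = ⊥-elim (separate j x j<s x∈ none (≡-sym e))
      ... | _ | outer none | _ | outer none′ = injective emb-f x x′ (outer∈ x x∈ none) (outer∈ x′ x′∈ none′) e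

      inner-edge : ∀ i x → i < s → x ∈ A → Adj G (p (suc i)) x ≡ true → g x ∈ R (y (suc i))
      inner-edge i x i<s x∈ e with interior i (s≤s i<s) x x∈ e
      ... | inj₁ refl = subst (_∈ R (y (suc i))) (≡-sym (on-path i (≤-trans (<⇒≤ i<s) (n≤1+n s))))
        (R-sym (y i) (y (suc i)) (y-red i (≤-trans i<s (n≤1+n s))))
      ... | inj₂ refl = subst (_∈ R (y (suc i))) (≡-sym (on-path (suc (suc i)) (s≤s i<s))) (y-red (suc i) (s≤s i<s))

      g-edges : ∀ x x′ → x ∈ A → x′ ∈ A → Adj G x x′ ≡ true → g x′ ∈ R (g x)
      g-edges x x′ x∈ x′∈ e with g x | view x | inspect-inner x x′ x∈ x′∈ e
        where
        inspect-inner : ∀ x x′ → x ∈ A → x′ ∈ A → Adj G x x′ ≡ true → ∀ i → i < s → p (suc i) ≡ x → g x′ ∈ R (y (suc i))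
        inspect-inner x x′ x∈ x′∈ e i i<s refl = inner-edge i x′ i<s x′∈ e
      ... | _ | inner i i<s q | done = done i i<s q
      ... | _ | outer none | _ with g x′ | view x′
      ... | _ | outer none′ = edges emb-f x x′ (outer∈ x x∈ none) (outer∈ x′ x′∈ none′) (∨-left e)
      ... | _ | inner j j<s refl with g x | view x | inner-edge j x j<s x∈ (adj-sym G x x′ e)
      ... | _ | outer _ | done = R-sym (y (suc j)) (f x) done
      ... | _ | inner i i<s q | _ = ⊥-elim (none i i<s q)

      rerouted : ∃ λ g → Emb G A g
      rerouted = g , emb g-injective g-edges

    fresh-path : ∀ w → w ∈ Outside → ∀ j → j ≤ s → ¬ w ≡ z j
    fresh-path w w∈ j h e = outside-≢ w (p (skip j)) w∈ (skip∈ j h) (≡-sym e)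

    -- Used with σ the identity or the reversal of a segment that starts at position suc c.
    insert-between : ∀ w c → w ∈ Outside → c < s → (σ : ℕ → ℕ) → (∀ i j → σ i ≡ σ j → i ≡ j) →
      (∀ i → i ≤ s → σ i ≤ s) → σ 0 ≡ 0 → σ s ≡ s →
      (∀ i → i < s → ¬ i ≡ c → z (σ (suc i)) ∈ R (z (σ i))) →
      w ∈ R (z (σ c)) → z (σ (suc c)) ∈ R w → ∃ λ g → Emb G A g
    insert-between w c w∈ c<s σ σ-injective σ-≤ σ0 σs chain left right = Reroute.rerouted (insert c w y)
      (insert-injective c w y s c<s (λ i j hi hj e → σ-injective i j (z-injective (σ i) (σ j) (σ-≤ i hi) (σ-≤ j hj) e))
        λ j h → fresh-path w w∈ (σ j) (σ-≤ j h))
      (cong z σ0) (trans (insert-last c w y s c<s) (cong z σs)) values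
      (insert-chain (λ u v → v ∈ R u) c w y s c<s chain left right)
      where
      y : ℕ → Fin N
      y = z ∘ σ
      values : ∀ i → i ≤ t → insert c w y i ∈ Outside ⊎ ∃ λ j → j ≤ s × insert c w y i ≡ z j
      values i i≤t with insert-value c w y s c<s i i≤t
      ... | inj₁ e = inj₁ (subst (_∈ Outside) (≡-sym e) w∈)
      ... | inj₂ (j , j≤ , e) = inj₂ (σ j , σ-≤ j j≤ , e)

    module _ (stuck : ¬ ∃ λ g → Emb G A g) where

      -- Otherwise `w` could be inserted between `z c` and its successor.
      successor-blue : ∀ w c → w ∈ Outside → c < s → z c ∈ R w → z (suc c) ∈ B w
      successor-blue w c w∈ c<s e with R⊎B w (z (suc c)) (fresh-path w w∈ (suc c) c<s)
      ... | inj₂ b = b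
      ... | inj₁ e′ = ⊥-elim (stuck (insert-between w c w∈ c<s (λ i → i) (λ _ _ e → e) (λ _ h → h) refl refl
        (λ i h _ → z-red i h) (R-sym w (z c) e) e′))

      -- If the two successors were joined in red, the path could run from `z a` through `w` to
      -- `z b`, back to `z (suc a)`, and on from `z (suc b)`: one vertex longer with the same ends.
      successors-blue : ∀ w a b → w ∈ Outside → a < b → b < s → z a ∈ R w → z b ∈ R w → z (suc b) ∈ B (z (suc a))
      successors-blue w a b w∈ a<b b<s ea eb
        with R⊎B (z (suc a)) (z (suc b)) (λ e → <-irrefl (suc-injective (z-injective (suc a) (suc b) (≤-trans a<b (<⇒≤ b<s)) b<s e)) a<b)
      ... | inj₂ bl = bl
      ... | inj₁ joint = ⊥-elim (stuck (insert-between w a w∈ (<-trans a<b b<s) reverse reverse-injective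
          (reverse-≤ s (<⇒≤ b<s)) (reverse-below 0 z≤n) (reverse-above s b<s)
          (reverse-chain (λ u v → v ∈ R u) (λ {u} {v} → R-sym u v) z s b<s z-red joint)
          (subst (λ i → w ∈ R (z i)) (≡-sym (reverse-below a ≤-refl)) (R-sym w (z a) ea))
          (subst (λ i → z i ∈ R w) (≡-sym reverse-start) eb)))
        where open Reversal a b a<b

      -- Only indices below `s`, since `z s` has no successor on the path.
      redIndices : Fin N → Sub s
      redIndices w i = R w (z (toℕ i))

      -- The successor of a fixed red neighbour forms a blue edge with `w`. The successors of the
      -- other red neighbours are common blue neighbours of its two ends, so there are fewer than
      -- `k` of them.
      few-red : ∀ w → w ∈ Outside → # (redIndices w) ≤ k
      few-red w w∈ with 0 <? # (redIndices w)
      ... | no h = ≤-trans (≮⇒≥ h) z≤n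
      ... | yes h with #-pos (redIndices w) h
      ... | i₀ , i₀∈ = ≤-trans (≤-reflexive (#-remove (redIndices w) i₀ i₀∈))
        (≤-trans (s≤s (#-injective-≤ (redIndices w - i₀) (B w ∩ B (z (suc (toℕ i₀)))) (λ i → z (suc (toℕ i))) into inj))
          (no-book w (z (suc (toℕ i₀))) (successor-blue w (toℕ i₀) w∈ (toℕ<n i₀) i₀∈)))
        where
        into : ∀ i → i ∈ redIndices w - i₀ → z (suc (toℕ i)) ∈ B w ∩ B (z (suc (toℕ i₀)))
        into i i∈ with ∈-remove⁻ (redIndices w) i∈
        ... | i∈′ , ne with <-cmp (toℕ i₀) (toℕ i)
        ... | tri< lt _ _ = ∧-intro (successor-blue w (toℕ i) w∈ (toℕ<n i) i∈′)
          (successors-blue w (toℕ i₀) (toℕ i) w∈ lt (toℕ<n i) i₀∈ i∈′)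
        ... | tri≈ _ e _ = ⊥-elim (ne (toℕ-injective e))
        ... | tri> _ _ gt = ∧-intro (successor-blue w (toℕ i) w∈ (toℕ<n i) i∈′)
          (B-sym (z (suc (toℕ i))) (z (suc (toℕ i₀))) (successors-blue w (toℕ i) (toℕ i₀) w∈ gt (toℕ<n i₀) i∈′ i₀∈))
        inj : ∀ i j → i ∈ redIndices w - i₀ → j ∈ redIndices w - i₀ → z (suc (toℕ i)) ≡ z (suc (toℕ j)) → i ≡ j
        inj i j _ _ e = toℕ-injective (suc-injective (z-injective (suc (toℕ i)) (suc (toℕ j)) (toℕ<n i) (toℕ<n j) e))

      -- Each of the two vertices is red to at most `k` of the `s` path vertices before the last. As
      -- `s` is at least `3 * k`, at least `k` are blue to both, so a blue edge would give a book.
      outside-red : ∀ w w′ → w ∈ Outside → w′ ∈ Outside → ¬ w ≡ w′ → w′ ∈ R w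
      outside-red w w′ w∈ w′∈ ne with R⊎B w w′ ne
      ... | inj₁ h = h
      ... | inj₂ bl = ⊥-elim (<-irrefl refl (begin-strict
          s                                          ≡⟨ #-full s ⟨
          # (full {s})                               ≤⟨ #-∖-≤ full I ⟩
          # I + # (full ∖ I)                         ≤⟨ +-mono-≤ (few-red w w∈) (#-∖-≤ (full ∖ I) I′) ⟩
          k + (# I′ + # (full ∖ I ∖ I′))             ≤⟨ +-monoʳ-≤ k (+-mono-≤ (few-red w′ w′∈)
                                                          (#-injective-≤ (full ∖ I ∖ I′) (B w ∩ B w′) (z ∘ toℕ) into inj)) ⟩
          k + (k + # (B w ∩ B w′))                   <⟨ +-monoʳ-< k (+-monoʳ-< k (no-book w w′ bl)) ⟩
          k + (k + k)                                ≡⟨ arith k ⟩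
          3 * k                                      ≤⟨ long ⟩
          s                                          ∎))
        where
        open ≤-Reasoning
        I = redIndices w
        I′ = redIndices w′
        arith : ∀ k → k + (k + k) ≡ 3 * k
        arith = solve-∀
        blue-to : ∀ u → u ∈ Outside → ∀ i → i ∉ redIndices u → z (toℕ i) ∈ B u
        blue-to u u∈ i i∉ with R⊎B u (z (toℕ i)) (fresh-path u u∈ (toℕ i) (<⇒≤ (toℕ<n i)))
        ... | inj₂ b = b
        ... | inj₁ h = ⊥-elim (true≢false h i∉)
        into : ∀ i → i ∈ full ∖ I ∖ I′ → z (toℕ i) ∈ B w ∩ B w′
        into i i∈ = ∧-intro (blue-to w w∈ i (not-elim (∧-left i∈))) (blue-to w′ w′∈ i (not-elim (∧-right {not (I i)} i∈)))
        inj : ∀ i j → i ∈ full ∖ I ∖ I′ → j ∈ full ∖ I ∖ I′ → z (toℕ i) ≡ z (toℕ j) → i ≡ j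
        inj i j _ _ e = toℕ-injective (z-injective (toℕ i) (toℕ j) (<⇒≤ (toℕ<n i)) (<⇒≤ (toℕ<n j)) e)

-- Numerical bounds, and adding leaves to an embedding

-- Polynomial inequalities are proved by giving the difference of the sides explicitly. Writing `k`
-- as `suc j` keeps its coefficients natural numbers, and the ring solver checks the identity.
≤-by : ∀ {a b} c → a + c ≡ b → a ≤ b
≤-by {a} c e = ≤-trans (m≤m+n a c) (≤-reflexive e)

module Bounds (n j l : ℕ)
  (few-extra : l * (119 * (suc j * suc j) + 62 * suc j) ≤ n) (many : 34 * (suc j * suc j * suc j) ≤ n) where

  k : ℕ
  k = suc j

  -- This is the room for the later stages of `base`: `i` vertices are used, and at most
  -- `2 * (i + l) * k` are blocked, out of `2n - 1`.
  base-bound : ∀ a i → a ≤ suc (3 * k) * (6 * l + 4 * 0 + 2) → i ≤ a → i + 2 * (i + l) * k < n + n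
  base-bound a i a≤ i≤a = begin-strict
    i + 2 * (i + l) * k                                    ≡⟨ regroup i l k ⟩
    i * (1 + 2 * k) + 2 * l * k                            ≤⟨ +-monoˡ-≤ (2 * l * k) (*-monoˡ-≤ (1 + 2 * k) (≤-trans i≤a a≤)) ⟩
    suc (3 * k) * (6 * l + 4 * 0 + 2) * (1 + 2 * k) + 2 * l * k
      <⟨ ≤-by (34 * (j * j * j) + 83 * (j * j * l) + 90 * (j * j) + 196 * (j * l) + 68 * j + 107 * l + 9) (identity j l) ⟩
    l * (119 * (k * k) + 62 * k) + 34 * (k * k * k)        ≤⟨ +-mono-≤ few-extra many ⟩
    n + n                                                  ∎
    where
    open ≤-Reasoning
    regroup : ∀ i l k → i + 2 * (i + l) * k ≡ i * (1 + 2 * k) + 2 * l * k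
    regroup = solve-∀
    identity : ∀ j l → suc (suc (3 * suc j) * (6 * l + 4 * 0 + 2) * (1 + 2 * suc j) + 2 * l * suc j)
      + (34 * (j * j * j) + 83 * (j * j * l) + 90 * (j * j) + 196 * (j * l) + 68 * j + 107 * l + 9)
      ≡ l * (119 * (suc j * suc j) + 62 * suc j) + 34 * (suc j * suc j * suc j)
    identity = solve-∀

  -- In `greedy-bound`, `6 * j + 2 * l` bounds the number of vertices once the minimum degree is at
  -- least 3.
  small-bound : (6 * j + 2 * l) * k ≤ n
  small-bound = *-cancelˡ-≤ 2 (begin
    2 * ((6 * j + 2 * l) * k)
      ≤⟨ ≤-by (34 * (j * j * j) + 119 * (j * j * l) + 90 * (j * j) + 296 * (j * l) + 90 * j + 177 * l + 34) (identity j l) ⟩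
    l * (119 * (k * k) + 62 * k) + 34 * (k * k * k)        ≤⟨ +-mono-≤ few-extra many ⟩
    n + n                                                  ≡⟨ cong (n +_) (+-identityʳ n) ⟨
    2 * n                                                  ∎)
    where
    open ≤-Reasoning
    identity : ∀ j l → 2 * ((6 * j + 2 * l) * suc j)
      + (34 * (j * j * j) + 119 * (j * j * l) + 90 * (j * j) + 296 * (j * l) + 90 * j + 177 * l + 34)
      ≡ l * (119 * (suc j * suc j) + 62 * suc j) + 34 * (suc j * suc j * suc j)
    identity = solve-∀

  mul-suc-bound : ∀ {b s} → b < s → s + b * j ≤ s * k
  mul-suc-bound {b} {s} b<s = ≤-trans (+-monoʳ-≤ s (*-monoˡ-≤ j (<⇒≤ b<s))) (≤-reflexive (≡-sym (*-suc s j)))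

  -- A minimum degree b ≥ 3 is only possible among at most 2 (p + l) vertices, where there is plenty of room.
  greedy-bound : ∀ p i b → p ≤ 2 * j → p + suc i + 2 * j ≤ n → b < p + suc i → b * suc i ≤ 2 * (p + suc i + l) →
    p + suc i + b * j ≤ n
  greedy-bound p i b p≤ fits b< sparse with b ≤? 2
  ... | yes b≤2 = ≤-trans (+-monoʳ-≤ (p + suc i) (*-monoˡ-≤ j b≤2)) fits
  ... | no b≰2 = ≤-trans (mul-suc-bound b<) (≤-trans (*-monoˡ-≤ k size) small-bound)
    where
    open ≤-Reasoning
    regroup : ∀ i p l → 2 * (p + suc i + l) ≡ (2 * p + 2 * l) + 2 * suc i
    regroup = solve-∀
    collect : ∀ p l → p + (2 * p + 2 * l) ≡ 3 * p + 2 * l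
    collect = solve-∀
    triple : ∀ i → suc i + 2 * suc i ≡ 3 * suc i
    triple = solve-∀
    few : suc i ≤ 2 * p + 2 * l
    few = +-cancelʳ-≤ (2 * suc i) _ _ (begin
      suc i + 2 * suc i           ≡⟨ triple i ⟩
      3 * suc i                   ≤⟨ *-monoˡ-≤ (suc i) (≰⇒> b≰2) ⟩
      b * suc i                   ≤⟨ sparse ⟩
      2 * (p + suc i + l)         ≡⟨ regroup i p l ⟩
      2 * p + 2 * l + 2 * suc i   ∎)
    six : ∀ j → 3 * (2 * j) ≡ 6 * j
    six = solve-∀
    size : p + suc i ≤ 6 * j + 2 * l
    size = begin
      p + suc i                ≤⟨ +-monoʳ-≤ p few ⟩
      p + (2 * p + 2 * l)      ≡⟨ collect p l ⟩
      3 * p + 2 * l            ≤⟨ +-monoˡ-≤ (2 * l) (*-monoʳ-≤ 3 p≤) ⟩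
      3 * (2 * j) + 2 * l      ≡⟨ cong (_+ 2 * l) (six j) ⟩
      6 * j + 2 * l            ∎

  -- A nearly spanning graph without a long suspended path has enough leaves for both cases of
  -- `Exact`: with fewer, the bound of `dichotomy` would stay too far below `n`.
  leaves-bound : ∀ a ℓ → n < a + 2 * j → a ≤ suc (3 * k) * (6 * l + 4 * ℓ + 2) → 2 * j * k ≤ ℓ
  leaves-bound a ℓ n< a≤ with 2 * j * k ≤? ℓ
  ... | yes h = h
  -- The factor 4 allows `few-extra` to be used once and `many` three times. The coefficients of the
  -- cube of `j` are then 96 on the left and 102 on the right.
  ... | no h = ⊥-elim (<-irrefl refl (begin-strict
      4 * n
        <⟨ *-monoʳ-< 4 n< ⟩
      4 * (a + 2 * j)
        ≤⟨ *-monoʳ-≤ 4 (+-monoˡ-≤ (2 * j) (≤-trans a≤ (*-monoʳ-≤ (suc (3 * k)) count))) ⟩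
      4 * (suc (3 * k) * (6 * l + 8 * j * k) + 2 * j)
        ≤⟨ ≤-by (6 * (j * j * j) + 119 * (j * j * l) + 82 * (j * j) + 228 * (j * l) + 170 * j + 85 * l + 102) (identity j l) ⟩
      l * (119 * (k * k) + 62 * k) + 3 * (34 * (k * k * k))
        ≤⟨ +-mono-≤ few-extra (*-monoʳ-≤ 3 many) ⟩
      n + 3 * n ∎))
    where
    open ≤-Reasoning
    four : ∀ ℓ → 4 * ℓ + 2 + 2 ≡ 4 * suc ℓ
    four = solve-∀
    eight : ∀ j k → 4 * (2 * j * k) ≡ 8 * j * k
    eight = solve-∀
    count : 6 * l + 4 * ℓ + 2 ≤ 6 * l + 8 * j * k
    count = ≤-trans (≤-reflexive (+-assoc (6 * l) (4 * ℓ) 2)) (+-monoʳ-≤ (6 * l)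
      (≤-trans (m≤m+n _ 2) (≤-trans (≤-reflexive (four ℓ)) (≤-trans (*-monoʳ-≤ 4 (≰⇒> h)) (≤-reflexive (eight j k))))))
    identity : ∀ j l → 4 * (suc (3 * suc j) * (6 * l + 8 * j * suc j) + 2 * j)
      + (6 * (j * j * j) + 119 * (j * j * l) + 82 * (j * j) + 228 * (j * l) + 170 * j + 85 * l + 102)
      ≡ l * (119 * (suc j * suc j) + 62 * suc j) + 3 * (34 * (suc j * suc j * suc j))
    identity = solve-∀

  parents-bound : 2 * j * k * (k + 1) ≤ n
  parents-bound = ≤-trans (≤-by (32 * (j * j * j) + 96 * (j * j) + 98 * j + 34) (identity j)) many
    where
    identity : ∀ j → 2 * j * suc j * (suc j + 1) + (32 * (j * j * j) + 96 * (j * j) + 98 * j + 34) ≡ 34 * (suc j * suc j * suc j)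
    identity = solve-∀

  clique-bound : 5 * j + 2 ≤ n
  clique-bound = ≤-trans (≤-by (34 * (j * j * j) + 102 * (j * j) + 97 * j + 32) (identity j)) many
    where
    identity : ∀ j → 5 * j + 2 + (34 * (j * j * j) + 102 * (j * j) + 97 * j + 32) ≡ 34 * (suc j * suc j * suc j)
    identity = solve-∀

  three-bound : 3 + 2 * j ≤ n
  three-bound = ≤-trans (≤-by (34 * (j * j * j) + 102 * (j * j) + 100 * j + 31) (identity j)) many
    where
    identity : ∀ j → 3 + 2 * j + (34 * (j * j * j) + 102 * (j * j) + 100 * j + 31) ≡ 34 * (suc j * suc j * suc j)
    identity = solve-∀

maximum : ∀ {m} (f : Fin (suc m) → ℕ) → ∃ λ v → ∀ y → f y ≤ f v
maximum {zero} f = zero , λ { zero → ≤-refl }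
maximum {suc m} f with maximum (f ∘ suc)
... | v , h with ≤-total (f zero) (f (suc v))
... | inj₁ le = suc v , λ { zero → le ; (suc y) → h y }
... | inj₂ ge = zero , λ { zero → ≤-refl ; (suc y) → ≤-trans (h y) ge }

-- Searching for embeddings, fixed hosts, and attaching leaves

module Embeddings {N} (χ : Colouring N) {n : ℕ} (y₀ : Fin N) where

  open Colours χ

  emb? : ∀ (G : Graph n) A f → Dec (Emb G A f)
  emb? G A f = map′ (λ (i , e) → emb (λ x y → i x y) (λ x y → e x y)) (λ (emb i e) → i , e)
    ((all? λ x → all? λ y → (A x ≟ᵇ true) →-dec (A y ≟ᵇ true) →-dec (f x ≟ f y) →-dec (x ≟ y)) ×-dec
     (all? λ x → all? λ y → (A x ≟ᵇ true) →-dec (A y ≟ᵇ true) →-dec (Adj G x y ≟ᵇ true) →-dec (R (f x) (f y) ≟ᵇ true)))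

  emb-cong : ∀ {G : Graph n} {A f g} → (∀ x → g x ≡ f x) → Emb G A f → Emb G A g
  emb-cong eq (emb i e) = emb (λ x y x∈ y∈ q → i x y x∈ y∈ (trans (≡-sym (eq x)) (trans q (eq y))))
    (λ x y x∈ y∈ a → subst₂ (λ u v → v ∈ R u) (≡-sym (eq x)) (≡-sym (eq y)) (e x y x∈ y∈ a))

  -- There are finitely many maps, and `finToFun` enumerates them up to pointwise equality, whence
  -- `emb-cong`. This decision makes the case distinction in `shorten` constructive.
  embeds? : ∀ (G : Graph n) A → Dec (∃ λ f → Emb G A f)
  embeds? G A = map′ (λ (i , e) → finToFun i , e) (λ (f , e) → funToFin f , emb-cong (finToFun-funToFin f) e)
    (any? λ i → emb? G A (finToFun i))

  embed-within : ∀ (G : Graph n) l A P → Sparse l G A → P ⊆ A → ∀ f₀ → Emb G P f₀ → ∀ H d →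
    (∀ x → x ∈ P → f₀ x ∈ H) → (∀ y → y ∈ H → # (H ∩ B y) ≤ d) →
    (∀ i b → # P + suc i ≤ # A → b < # P + suc i → b * suc i ≤ 2 * (# P + suc i + l) → # P + suc i + b * d ≤ # H) →
    ∃ λ f → Emb G A f × (∀ x → x ∈ A → f x ∈ H) × (∀ x → x ∈ P → f x ≡ f₀ x)
  embed-within G l A P sparse P⊆A f₀ emb₀ H d host₀ host-blue room =
    Greedy.greedy G l A P sparse f₀ emb₀ (λ _ → H) (λ _ → d) (λ _ _ e → e) host₀ (λ _ → host-blue) room
      (# (A ∖ P)) A P⊆A (λ _ e → e) (#-∖ A P P⊆A)

  embed-into : ∀ (G : Graph n) l A → Sparse l G A → ∀ H d → (∀ y → y ∈ H → # (H ∩ B y) ≤ d) →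
    (∀ i b → suc i ≤ # A → b < suc i → b * suc i ≤ 2 * (suc i + l) → suc i + b * d ≤ # H) →
    ∃ λ f → Emb G A f × (∀ x → x ∈ A → f x ∈ H)
  embed-into G l A sparse H d host-blue room with
    embed-within G l A empty sparse (λ _ ()) (λ _ → y₀) (emb-empty G _) H d (λ _ ()) host-blue room′
    where
    room′ : ∀ i b → # (empty {n}) + suc i ≤ # A → b < # (empty {n}) + suc i →
      b * suc i ≤ 2 * (# (empty {n}) + suc i + l) → # (empty {n}) + suc i + b * d ≤ # H
    room′ i b rewrite #-empty n = room i b
  ... | f , e , h , _ = f , e , h

  RedClique : Sub N → Set
  RedClique W = ∀ w w′ → w ∈ W → w′ ∈ W → ¬ w ≡ w′ → w′ ∈ R w

  clique-blue : ∀ W → RedClique W → ∀ y → y ∈ W → # (W ∩ B y) ≤ 0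
  clique-blue W clique y y∈ = ≮⇒≥ λ h → case #-pos (W ∩ B y) h of λ where
    (w , w∈) → R-B y w (clique y w y∈ (∧-left w∈) (B-≢ y w (∧-right {W w} w∈))) (∧-right {W w} w∈)

  embed-clique : ∀ (G : Graph n) l A → Sparse l G A → ∀ W → RedClique W → # A ≤ # W →
    ∃ λ f → Emb G A f × (∀ x → x ∈ A → f x ∈ W)
  embed-clique G l A sparse W clique fits = embed-into G l A sparse W 0 (clique-blue W clique)
    λ i b h _ _ → ≤-trans (≤-reflexive (trans (cong (suc i +_) (*-zeroʳ b)) (+-identityʳ (suc i)))) (≤-trans h fits)

  -- The leaves `Λ` go last, one by one, into the reservoir `Y`, which the rest of the graph avoids.
  -- Fewer than `# Λ` vertices of `Y` are taken before each step, so a red neighbour of the parent's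
  -- image is free. Parents lie outside `Λ`, hence no edge joins two of these leaves.
  module Attach (G : Graph n) (A Λ : Sub n) (q : Fin n → Fin n)
    (q∈ : ∀ u → u ∈ Λ → q u ∈ A ∖ Λ) (only : ∀ u y → u ∈ Λ → y ∈ A → Adj G u y ≡ true → q u ≡ y)
    (f : Fin n → Fin N) (emb-f : Emb G (A ∖ Λ) f)
    (Y : Sub N) (apart : ∀ x → x ∈ A ∖ Λ → f x ∉ Y) (supply : ∀ u → u ∈ Λ → # Λ ≤ # (Y ∩ R (f (q u))))
    (Λ⊆A : Λ ⊆ A) where

    attach-some : ∀ m M → M ⊆ Λ → # M ≡ m → ∃ λ g → Emb G ((A ∖ Λ) ∪ M) g × (∀ x → x ∈ A ∖ Λ → g x ≡ f x)
    attach-some zero M M⊆ size = f , emb-⊆ sub emb-f , λ _ _ → refl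
      where
      sub : (A ∖ Λ) ∪ M ⊆ A ∖ Λ
      sub x e with ∨-elim {(A ∖ Λ) x} e
      ... | inj₁ h = h
      ... | inj₂ h = case trans (≡-sym size) (#-remove M x h) of λ ()
    attach-some (suc m) M M⊆ size with #-pos M (≤-trans (s≤s z≤n) (≤-reflexive (≡-sym size)))
    ... | u , u∈ with attach-some m (M - u) (λ x e → M⊆ x (∧-left e)) (suc-injective (trans (≡-sym (#-remove M u u∈)) size))
    ... | g , emb-g , agrees with #-cancel-< (image g (M - u)) (Y ∩ R (f (q u)))
        (≤-trans (s≤s (#-image-≤ g (M - u))) (≤-trans (≤-reflexive (≡-sym (#-remove M u u∈)))
          (≤-trans (#-mono M Λ M⊆) (supply u (M⊆ u u∈)))))
    ... | y , y∈ , y∉ = g [ u ↦ y ] , extend G A⁺ u g y (emb-⊆ sub emb-g) fresh red-to , agrees′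
      where
      A⁺ = (A ∖ Λ) ∪ M
      u∈Λ : u ∈ Λ
      u∈Λ = M⊆ u u∈
      split : ∀ x → x ∈ A⁺ - u → x ∈ A ∖ Λ ⊎ x ∈ M - u
      split x e with ∨-elim {(A ∖ Λ) x} (∧-left e)
      ... | inj₁ h = inj₁ h
      ... | inj₂ h = inj₂ (∧-intro h (∧-right {A⁺ x} e))
      sub : A⁺ - u ⊆ (A ∖ Λ) ∪ (M - u)
      sub x e with split x e
      ... | inj₁ h = ∨-left h
      ... | inj₂ h = ∨-right {(A ∖ Λ) x} h
      fresh : y ∉ image g (A⁺ - u)
      fresh with ∈-dec (image g (A⁺ - u)) y
      ... | inj₂ h = h
      ... | inj₁ h with exists-elim (λ x → (A⁺ - u) x ∧ g x == y) h
      ... | x , e with ==⇒≡ (g x) y (∧-right {(A⁺ - u) x} e) | split x (∧-left {(A⁺ - u) x} e)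
      ... | refl | inj₁ x∈ = ⊥-elim (true≢false (∧-left y∈) (subst (_∉ Y) (≡-sym (agrees x x∈)) (apart x x∈)))
      ... | refl | inj₂ x∈ = ⊥-elim (true≢false (∈-image g (M - u) x∈) y∉)
      red-to : ∀ x → x ∈ A⁺ - u → Adj G u x ≡ true → y ∈ R (g x)
      red-to x e a with only u x u∈Λ (inA x (∧-left e)) a
        where
        inA : ∀ x → x ∈ A⁺ → x ∈ A
        inA x e with ∨-elim {(A ∖ Λ) x} e
        ... | inj₁ h = ∧-left h
        ... | inj₂ h = Λ⊆A x (M⊆ x h)
      ... | refl = subst (λ z → y ∈ R z) (≡-sym (agrees (q u) (q∈ u u∈Λ))) (∧-right {Y y} y∈)
      agrees′ : ∀ x → x ∈ A ∖ Λ → (g [ u ↦ y ]) x ≡ f x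
      agrees′ x x∈ = trans (update-other g u y λ { refl → true≢false u∈Λ (not-elim (∧-right {A u} x∈)) }) (agrees x x∈)

    attach : ∃ λ g → Emb G A g
    attach with attach-some (# Λ) Λ (λ _ e → e) refl
    ... | g , e , _ = g , emb-⊆ sub e
      where
      sub : A ⊆ (A ∖ Λ) ∪ Λ
      sub x x∈ with ∈-dec Λ x
      ... | inj₁ h = ∨-right {(A ∖ Λ) x} h
      ... | inj₂ h = ∨-left (∧-intro x∈ (not-intro h))

-- The upper bound

-- The parameter of the book is `suc j`, and `order` expresses `N = 2n - 1` without subtraction.
module Upper {N} (χ : Colouring N) {n} (j l : ℕ) (no-book : NoBook χ (suc j)) (order : suc N ≡ n + n)
  (few-extra : l * (119 * (suc j * suc j) + 62 * suc j) ≤ n) (many : 34 * (suc j * suc j * suc j) ≤ n) (y₀ : Fin N) where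

  open Colours χ
  open Bounds n j l few-extra many
  open Embeddings χ {n} y₀

  Embeds : Graph n → Sub n → Set
  Embeds G A = ∃ λ f → Emb G A f

  blue-blue-≤ : ∀ u v → v ∈ B u → # (B u ∩ B v) ≤ j
  blue-blue-≤ u v e = s≤s⁻¹ (no-book u v e)

  -- The induction hypothesis. It ranges over all graphs on the vertex type because `shorten` adds
  -- an edge.
  Smaller : Sub n → Set
  Smaller A = ∀ (G : Graph n) A′ → suc (# A′) ≡ # A → Conn G A′ → Sparse l G A′ → Embeds G A′

  shorten : ∀ (G : Graph n) A p → # A ≤ n → Conn G A → Sparse l G A → Suspended G A (suc (3 * k)) p → Smaller A → Embeds G A
  shorten G A p A≤n conn sparse susp smaller with smaller G′ (A - v) (≡-sym (#-remove A v v∈)) conn′ sparse′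
    where
    open Suspended susp
    v = p 1
    long : 2 ≤ suc (3 * k)
    long = s≤s (s≤s z≤n)
    v∈ : v ∈ A
    v∈ = inside 1 (s≤s z≤n)
    ends : ¬ p 0 ≡ p 2
    ends e = case distinct 0 2 z≤n long e of λ ()
    G′ = addEdge G (p 0) (p 2) ends
    va : Adj G v (p 0) ≡ true
    va = adj-sym G (p 0) v (adjacent 0 (s≤s z≤n))
    vb : Adj G v (p 2) ≡ true
    vb = adjacent 1 long
    sparse′ : Sparse l G′ (A - v)
    sparse′ = sparse-contract G l A v (p 0) (p 2) ends sparse v∈ va vb
    bridge : ∀ x y → x ∈ A - v → y ∈ A - v → Adj G v x ≡ true → Adj G v y ≡ true → x ≡ y ⊎ Adj G′ x y ≡ true
    bridge x y x∈ y∈ ex ey with interior 0 long x (∧-left x∈) ex | interior 0 long y (∧-left y∈) ey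
    ... | inj₁ refl | inj₁ refl = inj₁ refl
    ... | inj₂ refl | inj₂ refl = inj₁ refl
    ... | inj₁ refl | inj₂ refl = inj₂ (addEdge-new G (p 0) (p 2) ends)
    ... | inj₂ refl | inj₁ refl = inj₂ (adj-sym G′ (p 0) (p 2) (addEdge-new G (p 0) (p 2) ends))
    conn′ : Conn G′ (A - v)
    conn′ = conn-remove G G′ A v conn (λ x y → ∨-left) bridge
  ... | f , emb-f with embeds? G A
  ... | yes done = done
  ... | no stuck with embed-clique G l A sparse (full ∖ image f (A - p 1)) clique fits
    where
    open Suspended susp
    clique : RedClique (full ∖ image f (A - p 1))
    -- The path has `3 * k + 1` edges and the contracted one `3 * k`, exactly the length that
    -- `Lengthen` demands.
    clique = Lengthen.outside-red χ k no-book G A _ p susp ≤-refl _ f emb-f stuck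
    open ≤-Reasoning
    fits : # A ≤ # (full ∖ image f (A - p 1))
    fits = ≤-trans A≤n (+-cancelˡ-≤ n _ _ (begin
      n + n                                                    ≡⟨ order ⟨
      suc N                                                    ≡⟨ cong suc (#-complement (image f (A - p 1))) ⟩
      suc (# (image f (A - p 1)) + # (full ∖ image f (A - p 1)))
        ≤⟨ s≤s (+-monoˡ-≤ _ (#-image-≤ f (A - p 1))) ⟩
      suc (# (A - p 1)) + # (full ∖ image f (A - p 1))
        ≡⟨ cong (_+ # (full ∖ image f (A - p 1))) (#-remove A (p 1) (inside 1 (s≤s z≤n))) ⟨
      # A + # (full ∖ image f (A - p 1))                       ≤⟨ +-monoˡ-≤ _ A≤n ⟩
      n + # (full ∖ image f (A - p 1))                         ∎))
  ... | g , e , _ = g , e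

  -- The summand `4 * 0` is the leaf term of `dichotomy` for a graph without leaves. A vertex `v` of
  -- largest blue degree supplies two things: a host with blue degrees at most `j`, and a bound on
  -- all blue degrees.
  base : ∀ (G : Graph n) A → Sparse l G A → # A ≤ suc (3 * k) * (6 * l + 4 * 0 + 2) → Embeds G A
  base G A sparse small with max-blue y₀
    where
    -- `maximum` requires a nonempty index set, and `y₀` rules out `N = 0`.
    max-blue : ∀ {N} → Fin N → {f : Fin N → ℕ} → ∃ λ v → ∀ y → f y ≤ f v
    max-blue {suc N} _ {f} = maximum f
  ... | v , v-max with Greedy.greedy G l A empty sparse (λ _ → y₀) (emb-empty G _) Host Δ host-mono (λ _ ()) host-blue room
      (# A) A (λ _ ()) (λ _ e → e) (cong (_+ # A) (≡-sym (#-empty n)))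
    where
    D = # (B v)
    -- The first D / k vertices go into the blue neighbourhood of v, the others anywhere: then D < i * k, and the
    -- degree bound b * i ≤ 2 * (i + l) gives b * D ≤ 2 * (i + l) * k.
    Host : ℕ → Sub N
    Host i with i * k ≤? D
    ... | yes _ = B v
    ... | no _ = full
    Δ : ℕ → ℕ
    Δ i with i * k ≤? D
    ... | yes _ = j
    ... | no _ = D
    host-mono : ∀ i → Host i ⊆ Host (suc i)
    host-mono i x e with i * k ≤? D | suc i * k ≤? D
    ... | yes _ | yes _ = e
    ... | no h | yes h′ = ⊥-elim (h (≤-trans (*-monoˡ-≤ k (n≤1+n i)) h′))
    ... | _ | no _ = refl
    host-blue : ∀ i y → y ∈ Host i → # (Host i ∩ B y) ≤ Δ i
    host-blue i y e with i * k ≤? D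
    ... | yes _ = blue-blue-≤ v y e
    ... | no _ = ≤-trans (#-mono (full ∩ B y) (B y) λ _ e → e) (v-max y)
    open ≤-Reasoning
    room : ∀ i b → # (empty {n}) + suc i ≤ # A → b < # (empty {n}) + suc i →
      b * suc i ≤ 2 * (# (empty {n}) + suc i + l) → # (empty {n}) + suc i + b * Δ (suc i) ≤ # (Host (suc i))
    room i b rewrite #-empty n with suc i * k ≤? D
    ... | yes h = λ _ b< _ → ≤-trans (mul-suc-bound b<) h
    ... | no h = λ i≤ _ sp → s≤s⁻¹ (begin-strict
      suc i + b * D                       ≤⟨ +-monoʳ-≤ (suc i) (*-monoʳ-≤ b (<⇒≤ (≰⇒> h))) ⟩
      suc i + b * (suc i * k)             ≡⟨ cong (suc i +_) (*-assoc b (suc i) k) ⟨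
      suc i + b * suc i * k               ≤⟨ +-monoʳ-≤ (suc i) (*-monoˡ-≤ k sp) ⟩
      suc i + 2 * (suc i + l) * k         <⟨ base-bound (# A) (suc i) small i≤ ⟩
      n + n                               ≡⟨ order ⟨
      suc N                               ≡⟨ cong suc (#-full N) ⟨
      suc (# (full {N}))                  ∎)
  ... | f , e , _ = f , e

  -- A vertex that is no leaf gets itself as a filler value.
  parent : Graph n → Sub n → Fin n → Fin n
  parent G A u with ∈-dec (Leaf G A) u
  ... | inj₁ h = proj₁ (leaf-unique G A u h)
  ... | inj₂ _ = u

  parent-spec : ∀ G A u → u ∈ Leaf G A → (parent G A u ∈ A × Adj G u (parent G A u) ≡ true) ×
    (∀ y → y ∈ A → Adj G u y ≡ true → parent G A u ≡ y)
  parent-spec G A u u∈ with ∈-dec (Leaf G A) u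
  ... | inj₁ h = proj₂ (leaf-unique G A u h)
  ... | inj₂ h = ⊥-elim (true≢false u∈ h)

  -- Two adjacent leaves would form a component with only two vertices.
  parent-not-leaf : ∀ G A u → Conn G A → 3 ≤ # A → u ∈ Leaf G A → parent G A u ∉ Leaf G A
  parent-not-leaf G A u conn large u∈ with ∈-dec (Leaf G A) (parent G A u)
  ... | inj₂ h = h
  ... | inj₁ p∈ = ⊥-elim (<⇒≱ large (begin
      # A                             ≤⟨ #-mono A S (conn S u (∨-left (==-refl u)) S⊆ closed) ⟩
      # S                             ≤⟨ #-∪-≤ (u ==_) (p ==_) ⟩
      # (u ==_) + # (p ==_)           ≡⟨ cong₂ _+_ (#-single u) (#-single p) ⟩
      2                               ∎))
    where
    open ≤-Reasoning
    p = parent G A u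
    S = (u ==_) ∪ (p ==_)
    pu : parent G A p ≡ u
    pu = proj₂ (parent-spec G A p p∈) u (∧-left u∈) (adj-sym G u p (proj₂ (proj₁ (parent-spec G A u u∈))))
    S⊆ : S ⊆ A
    S⊆ x e with ∨-elim {u == x} e
    ... | inj₁ h = subst (_∈ A) (==⇒≡ u x h) (∧-left u∈)
    ... | inj₂ h = subst (_∈ A) (==⇒≡ p x h) (∧-left p∈)
    closed : ∀ x y → x ∈ S → y ∈ A → Adj G x y ≡ true → y ∈ S
    closed x y x∈ y∈ e with ∨-elim {u == x} x∈
    ... | inj₁ h with ==⇒≡ u x h
    ... | refl = ∨-right {u == y} (subst (λ z → p == z ≡ true) (proj₂ (parent-spec G A u u∈) y y∈ e) (==-refl p))
    closed x y x∈ y∈ e | inj₂ h with ==⇒≡ p x h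
    ... | refl = ∨-left (subst (λ z → u == z ≡ true) (trans (≡-sym pu) (proj₂ (parent-spec G A p p∈) y y∈ e)) (==-refl u))

  conn-remove-leaf : ∀ G A u → Conn G A → u ∈ Leaf G A → Conn G (A - u)
  conn-remove-leaf G A u conn u∈ = conn-remove G G A u conn (λ _ _ e → e)
    λ x y x∈ y∈ ex ey → inj₁ (trans (≡-sym (only x (∧-left x∈) ex)) (only y (∧-left y∈) ey))
    where
    only = proj₂ (parent-spec G A u u∈)

  -- The image of the parent has at least `n - 1` red neighbours. At most `n - 1` vertices are used,
  -- and one of these is that image itself, not a red neighbour of its own; so some red neighbour is
  -- free.
  add-leaf : (∀ y → # (B y) < n) → ∀ (G : Graph n) A u → # A ≤ n → u ∈ Leaf G A → Embeds G (A - u) → Embeds G A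
  add-leaf low G A u A≤n u∈ (f , emb-f) with #-cancel-< (used - f p) (R (f p)) supply
    where
    p = parent G A u
    used = image f (A - u)
    spec = parent-spec G A u u∈
    p∈ : p ∈ A - u
    p∈ = ∈-remove A u (proj₁ (proj₁ spec)) (neighbour-≢ G u p (proj₂ (proj₁ spec)))
    open ≤-Reasoning
    red-many : n ≤ suc (# (R (f p)))
    red-many = +-cancelˡ-≤ n _ _ (begin
      n + n                                             ≡⟨ order ⟨
      suc N                                             ≡⟨ cong suc (#-full N) ⟨
      suc (# (full {N}))                                ≤⟨ s≤s (#-mono full ((f p ==_) ∪ (B (f p) ∪ R (f p))) (colours-cover (f p))) ⟩
      suc (# ((f p ==_) ∪ (B (f p) ∪ R (f p))))         ≤⟨ s≤s (#-∪-≤ (f p ==_) (B (f p) ∪ R (f p))) ⟩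
      suc (# (f p ==_) + # (B (f p) ∪ R (f p)))         ≡⟨ cong (λ t → suc (t + # (B (f p) ∪ R (f p)))) (#-single (f p)) ⟩
      2 + # (B (f p) ∪ R (f p))                         ≤⟨ +-monoʳ-≤ 2 (#-∪-≤ (B (f p)) (R (f p))) ⟩
      2 + (# (B (f p)) + # (R (f p)))                   ≡⟨ cong suc (+-suc (# (B (f p))) (# (R (f p)))) ⟨
      suc (# (B (f p))) + suc (# (R (f p)))             ≤⟨ +-monoˡ-≤ _ (low (f p)) ⟩
      n + suc (# (R (f p)))                             ∎)
    supply : # (used - f p) < # (R (f p))
    supply = s≤s⁻¹ (begin-strict
      suc (# (used - f p))                              ≡⟨ #-remove used (f p) (∈-image f (A - u) p∈) ⟨
      # used                                            ≤⟨ #-image-≤ f (A - u) ⟩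
      # (A - u)                                         <⟨ ≤-refl ⟩
      suc (# (A - u))                                   ≡⟨ #-remove A u (∧-left u∈) ⟨
      # A                                               ≤⟨ A≤n ⟩
      n                                                 ≤⟨ red-many ⟩
      suc (# (R (f p)))                                 ∎)
  ... | y , y∈ , y∉ = f [ u ↦ y ] , extend G A u f y emb-f fresh red-to
    where
    fresh : y ∉ image f (A - u)
    fresh with ∈-dec (image f (A - u)) y
    ... | inj₂ h = h
    ... | inj₁ h = ⊥-elim (true≢false (∈-remove (image f (A - u)) (f (parent G A u)) h (R-≢ _ y y∈)) y∉)
    red-to : ∀ x → x ∈ A - u → Adj G u x ≡ true → y ∈ R (f x)
    red-to x x∈ e = subst (λ z → y ∈ R (f z)) (proj₂ (parent-spec G A u u∈) x (∧-left x∈) e) y∈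

  -- The case of n vertices in one blue neighbourhood

  module Exact (x : Fin N) (W : Sub N) (W⊆ : W ⊆ B x) (#W : # W ≡ n)
    (G : Graph n) (A : Sub n) (A≤n : # A ≤ n) (three : 3 ≤ # A) (conn : Conn G A) (sparse : Sparse l G A)
    (leaves : 2 * j * k ≤ # (Leaf G A)) where

    -- The threshold `2 * j` is the number of leaves that `many-Z` places in `U`; they might all
    -- have the same parent.
    U Z T : Sub N
    U = full ∖ W
    Z y = W y ∧ (2 * j ≤ᵇ # (U ∩ R y))
    T = W ∖ Z

    Z⊆W : Z ⊆ W
    Z⊆W y = ∧-left

    W-blue : ∀ y → y ∈ W → # (W ∩ B y) ≤ j
    W-blue y y∈ = ≤-trans (#-mono (W ∩ B y) (B x ∩ B y) λ w e → ∧-intro (W⊆ w (∧-left e)) (∧-right {W w} e))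
      (blue-blue-≤ x y (W⊆ y y∈))

    Z-supply : ∀ y → y ∈ Z → 2 * j ≤ # (U ∩ R y)
    Z-supply y y∈ = ≤ᵇ⇒≤ (2 * j) (# (U ∩ R y)) (subst IsTrue (≡-sym (∧-right {W y} y∈)) _)

    T-demand : ∀ y → y ∈ T → # (U ∩ R y) < 2 * j
    T-demand y y∈ = ≰⇒> λ h → true≢false {2 * j ≤ᵇ # (U ∩ R y)} (T⇒≡ (≤⇒≤ᵇ h))
      (not-both (∧-left y∈) (not-elim (∧-right {W y} y∈)))
      where
      T⇒≡ : ∀ {b} → IsTrue b → b ≡ true
      T⇒≡ {true} _ = refl
      not-both : ∀ {a b} → a ≡ true → a ∧ b ≡ false → b ≡ false
      not-both refl e = e

    #U : suc (# U) ≡ n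
    #U = +-cancelˡ-≡ n _ _ (trans (+-suc n (# U)) (trans (cong suc (trans (cong (_+ # U) (≡-sym #W)) (≡-sym (#-complement W)))) order))

    -- If the edge were blue, every vertex of `U` would be red to one of its ends or a common blue
    -- neighbour of both. That covers at most `5 * j` vertices, but `U` has `n - 1`.
    T-clique : RedClique T
    T-clique y y′ y∈ y′∈ ne with R⊎B y y′ ne
    ... | inj₁ h = h
    ... | inj₂ bl = ⊥-elim (<-irrefl refl (begin-strict
        n                                             ≡⟨ #U ⟨
        suc (# U)                                     ≤⟨ s≤s (#-mono U ((U ∩ R y) ∪ ((U ∩ R y′) ∪ (B y ∩ B y′))) cover) ⟩
        suc (# ((U ∩ R y) ∪ ((U ∩ R y′) ∪ (B y ∩ B y′))))
          ≤⟨ s≤s (≤-trans (#-∪-≤ (U ∩ R y) ((U ∩ R y′) ∪ (B y ∩ B y′))) (+-monoʳ-≤ _ (#-∪-≤ (U ∩ R y′) (B y ∩ B y′)))) ⟩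
        suc (# (U ∩ R y) + (# (U ∩ R y′) + # (B y ∩ B y′)))
          ≤⟨ s≤s (+-mono-≤ (<⇒≤ (T-demand y y∈)) (+-mono-≤ (<⇒≤ (T-demand y′ y′∈)) (blue-blue-≤ y y′ bl))) ⟩
        suc (2 * j + (2 * j + j))                     <⟨ ≤-reflexive (arith j) ⟩
        5 * j + 2                                     ≤⟨ clique-bound ⟩
        n                                             ∎))
      where
      open ≤-Reasoning
      arith : ∀ j → suc (suc (2 * j + (2 * j + j))) ≡ 5 * j + 2
      arith = solve-∀
      apart : ∀ u v → u ∈ U → v ∈ T → ¬ v ≡ u
      apart u v u∈ v∈ refl = true≢false (∧-left v∈) (not-elim u∈)
      cover : U ⊆ (U ∩ R y) ∪ ((U ∩ R y′) ∪ (B y ∩ B y′))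
      cover u u∈ with R⊎B y u (apart u y u∈ y∈) | R⊎B y′ u (apart u y′ u∈ y′∈)
      ... | inj₁ h | _ = ∨-left (∧-intro u∈ h)
      ... | inj₂ _ | inj₁ h = ∨-right {(U ∩ R y) u} (∨-left (∧-intro u∈ h))
      ... | inj₂ h | inj₂ h′ = ∨-right {(U ∩ R y) u} (∨-right {(U ∩ R y′) u} (∧-intro h h′))

    -- The order of embedding is: the parents `P` of the chosen leaves, then the other vertices
    -- outside `Λ`, then the leaves `Λ`.
    module Stages (m : ℕ) (Λ : Sub n) (Λ⊆ : Λ ⊆ Leaf G A) (#Λ : # Λ ≡ m) where

      q : Fin n → Fin n
      q = parent G A

      P : Sub n
      P = image q Λ

      #P : # P ≤ m
      #P = ≤-trans (#-image-≤ q Λ) (≤-reflexive #Λ)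

      Λ⊆A : Λ ⊆ A
      Λ⊆A u e = ∧-left (Λ⊆ u e)

      q∈ : ∀ u → u ∈ Λ → q u ∈ A ∖ Λ
      q∈ u u∈ = ∧-intro (proj₁ (proj₁ (parent-spec G A u (Λ⊆ u u∈)))) (not-intro not-in)
        where
        not-in : q u ∉ Λ
        not-in with ∈-dec Λ (q u)
        ... | inj₂ h = h
        ... | inj₁ h = ⊥-elim (true≢false (Λ⊆ (q u) h) (parent-not-leaf G A u conn three (Λ⊆ u u∈)))

      P⊆ : P ⊆ A ∖ Λ
      P⊆ y e with exists-elim (λ u → Λ u ∧ q u == y) e
      ... | u , u∈ = subst (_∈ A ∖ Λ) (==⇒≡ (q u) y (∧-right {Λ u} u∈)) (q∈ u (∧-left u∈))

      sparse-rest : Sparse l G (A ∖ Λ)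
      sparse-rest = sparse-⊆ {G = G} (λ _ → ∧-left) sparse

      sparse-P : Sparse l G P
      sparse-P = sparse-⊆ {G = G} P⊆ sparse-rest

      #rest : m + # (A ∖ Λ) ≡ # A
      #rest = trans (cong (_+ # (A ∖ Λ)) (≡-sym #Λ)) (≡-sym (#-∖ A Λ Λ⊆A))

      -- `H` hosts everything but the leaves, and `Y` receives the leaves; `f₀` has placed each
      -- parent where it has enough red neighbours in `Y`.
      finish : ∀ H Y d → (∀ y → y ∈ H → y ∉ Y) → (∀ y → y ∈ H → # (H ∩ B y) ≤ d) →
        (∀ i b → # P + suc i ≤ # (A ∖ Λ) → b < # P + suc i → b * suc i ≤ 2 * (# P + suc i + l) → # P + suc i + b * d ≤ # H) →
        ∀ f₀ → Emb G P f₀ → (∀ v → v ∈ P → f₀ v ∈ H × m ≤ # (Y ∩ R (f₀ v))) → Embeds G A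
      finish H Y d apart host-blue room f₀ emb₀ good
        with embed-within G l (A ∖ Λ) P sparse-rest P⊆ f₀ emb₀ H d (λ v e → proj₁ (good v e)) host-blue room
      ... | f , emb-f , in-H , agrees = Attach.attach G A Λ q q∈ (λ u y u∈ → proj₂ (parent-spec G A u (Λ⊆ u u∈)) y)
          f emb-f Y (λ v e → apart (f v) (in-H v e)) supply Λ⊆A
        where
        supply : ∀ u → u ∈ Λ → # Λ ≤ # (Y ∩ R (f (q u)))
        supply u u∈ = subst₂ _≤_ (≡-sym #Λ) (cong (λ t → # (Y ∩ R t)) (≡-sym (agrees (q u) (∈-image q Λ u∈))))
          (proj₂ (good (q u) (∈-image q Λ u∈)))

    2j≤ : 2 * j ≤ # (Leaf G A)
    2j≤ = ≤-trans (m≤m*n (2 * j) k) leaves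

    -- At most `2 * j` parents fit into `Z`, because blue degrees there are at most `j`. The other
    -- vertices go into `W`, and the leaves into `U` by the definition of `Z`.
    many-Z : 2 * j * k ≤ # Z → Embeds G A
    many-Z Z≥ with subset-of-size (Leaf G A) (2 * j) 2j≤
    ... | Λ , Λ⊆ , #Λ with embed-into G l (Stages.P (2 * j) Λ Λ⊆ #Λ) (Stages.sparse-P (2 * j) Λ Λ⊆ #Λ) Z j
        (λ y y∈ → ≤-trans (#-mono (Z ∩ B y) (W ∩ B y) λ w e → ∧-intro (Z⊆W w (∧-left e)) (∧-right {Z w} e)) (W-blue y (Z⊆W y y∈)))
        (λ i b i≤ b< _ → ≤-trans (mul-suc-bound b<) (≤-trans (*-monoˡ-≤ k (≤-trans i≤ (Stages.#P (2 * j) Λ Λ⊆ #Λ))) Z≥))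
    ... | f₀ , emb₀ , in-Z = finish W U j (λ y y∈ → subst (λ b → true ∧ not b ≡ false) (≡-sym y∈) refl) W-blue room f₀ emb₀
        (λ v e → Z⊆W (f₀ v) (in-Z v e) , Z-supply (f₀ v) (in-Z v e))
      where
      open Stages (2 * j) Λ Λ⊆ #Λ
      -- The `2 * j` leaves kept out of `W` are the slack that `greedy-bound` requires.
      room : ∀ i b → # P + suc i ≤ # (A ∖ Λ) → b < # P + suc i → b * suc i ≤ 2 * (# P + suc i + l) → # P + suc i + b * j ≤ # W
      room i b i≤ b< sp = ≤-trans (greedy-bound (# P) i b #P
        (≤-trans (+-monoˡ-≤ (2 * j) i≤) (≤-trans (≤-reflexive (trans (+-comm _ (2 * j)) #rest)) A≤n)) b< sp) (≤-reflexive (≡-sym #W))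

    near : Sub N
    near = bind Z (λ z → W ∩ B z)

    T′ : Sub N
    T′ = T ∖ near

    T′-red : ∀ y → y ∈ T′ → Z ⊆ Z ∩ R y
    T′-red y y∈ z z∈ with R⊎B y z (λ { refl → true≢false z∈ (not-elim (∧-right {W y} (∧-left y∈))) })
    ... | inj₁ h = ∧-intro z∈ h
    ... | inj₂ h = ⊥-elim (true≢false (exists-intro (λ z → Z z ∧ (W ∩ B z) y) z
      (∧-intro z∈ (∧-intro (∧-left {W y} (∧-left {T y} y∈)) (B-sym y z h)))) (not-elim (∧-right {T y} y∈)))

    near-≤ : # near ≤ # Z * j
    near-≤ = ≤-trans (#-bind Z (λ z → W ∩ B z)) (#-weighted-≤ Z (λ z → # (W ∩ B z)) j λ z e → W-blue z (Z⊆W z e))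

    W-split : n ≡ # Z + # T
    W-split = trans (≡-sym #W) (#-∖ W Z Z⊆W)

    -- Each vertex of `Z` has at most `j` blue neighbours in `W`, so removing `Z` and these
    -- neighbours costs at most `# Z * k` of the `n` vertices of `W`.
    T′-large : # Z ≤ 2 * j * k → # Z ≤ # T′
    T′-large Z≤ = +-cancelˡ-≤ (# Z * k) (# Z) (# T′) (begin
      # Z * k + # Z                     ≡⟨ regroup (# Z) k ⟩
      # Z * (k + 1)                     ≤⟨ *-monoˡ-≤ (k + 1) Z≤ ⟩
      2 * j * k * (k + 1)               ≤⟨ parents-bound ⟩
      n                                 ≡⟨ W-split ⟩
      # Z + # T                         ≤⟨ +-monoʳ-≤ (# Z) (#-∖-≤ T near) ⟩
      # Z + (# near + # T′)             ≤⟨ +-monoʳ-≤ (# Z) (+-monoˡ-≤ (# T′) near-≤) ⟩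
      # Z + (# Z * j + # T′)            ≡⟨ +-assoc (# Z) (# Z * j) (# T′) ⟨
      # Z + # Z * j + # T′              ≡⟨ cong (_+ # T′) (*-suc (# Z) j) ⟨
      # Z * k + # T′                    ∎)
      where
      open ≤-Reasoning
      regroup : ∀ z k → z * k + z ≡ z * (k + 1)
      regroup = solve-∀

    -- The leaves fill `Z` completely. Their parents go into `T′`, which is red to all of `Z`, and
    -- the remaining vertices fit into the red clique `T` because `# Z` and `# T` add up to `n`.
    module FewZ (Λ : Sub n) (Λ⊆ : Λ ⊆ Leaf G A) (#Λ : # Λ ≡ # Z) (Z≤ : # Z ≤ 2 * j * k) where

      open Stages (# Z) Λ Λ⊆ #Λ

      parents : ∃ λ f → Emb G P f × (∀ v → v ∈ P → f v ∈ T′)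
      parents = embed-clique G l P sparse-P T′ (λ y y′ y∈ y′∈ → T-clique y y′ (∧-left y∈) (∧-left y′∈)) (≤-trans #P (T′-large Z≤))

      rest-fits : # (A ∖ Λ) ≤ # T
      rest-fits = +-cancelˡ-≤ (# Z) (# (A ∖ Λ)) (# T) (≤-trans (≤-reflexive #rest) (≤-trans A≤n (≤-reflexive W-split)))

      room : ∀ i b → # P + suc i ≤ # (A ∖ Λ) → b < # P + suc i → b * suc i ≤ 2 * (# P + suc i + l) → # P + suc i + b * 0 ≤ # T
      room i b i≤ _ _ = ≤-trans (≤-reflexive (trans (cong (# P + suc i +_) (*-zeroʳ b)) (+-identityʳ (# P + suc i))))
        (≤-trans i≤ rest-fits)

      completed : Embeds G A
      completed = finish T Z 0 (λ y y∈ → not-elim (∧-right {W y} y∈)) (clique-blue T T-clique) room (proj₁ parents)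
        (proj₁ (proj₂ parents)) good
        where
        good : ∀ v → v ∈ P → proj₁ parents v ∈ T × # Z ≤ # (Z ∩ R (proj₁ parents v))
        good v e = ∧-left (proj₂ (proj₂ parents) v e) ,
          #-mono Z (Z ∩ R (proj₁ parents v)) (T′-red (proj₁ parents v) (proj₂ (proj₂ parents) v e))

    few-Z : # Z ≤ 2 * j * k → Embeds G A
    few-Z Z≤ = fill (subset-of-size (Leaf G A) (# Z) (≤-trans Z≤ leaves))
      where
      fill : (∃ λ Λ → Λ ⊆ Leaf G A × # Λ ≡ # Z) → Embeds G A
      fill (Λ , Λ⊆ , #Λ) = FewZ.completed Λ Λ⊆ #Λ Z≤

    exact : Embeds G A
    exact = by-size (≤-total (2 * j * k) (# Z))
      where
      by-size : 2 * j * k ≤ # Z ⊎ # Z ≤ 2 * j * k → Embeds G A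
      by-size (inj₁ h) = many-Z h
      by-size (inj₂ h) = few-Z h

  forget : ∀ {G A} {Q : (Fin n → Fin N) → Set} → (∃ λ f → Emb G A f × Q f) → Embeds G A
  forget (f , e , _) = f , e

  -- With `2 * j` vertices to spare, the greedy embedding succeeds inside the blue neighbourhood.
  -- Otherwise the graph is nearly spanning, and it has a long suspended path or the leaves that
  -- `Exact` needs.
  embed-high : ∀ x → n ≤ # (B x) → ∀ (G : Graph n) A → # A ≤ n → Conn G A → Sparse l G A → Smaller A → Embeds G A
  embed-high x high G A A≤n conn sparse smaller = by-room (# A + 2 * j ≤? n)
    where
    room : # A + 2 * j ≤ n → ∀ i b → suc i ≤ # A → b < suc i → b * suc i ≤ 2 * (suc i + l) → suc i + b * j ≤ # (B x)
    room fits i b i≤ b< sp = ≤-trans (greedy-bound 0 i b z≤n (≤-trans (+-monoˡ-≤ (2 * j) i≤) fits) b< sp) high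
    three : n < # A + 2 * j → 3 ≤ # A
    three tight = +-cancelʳ-≤ (2 * j) 3 (# A) (≤-trans three-bound (<⇒≤ tight))
    by-shape : n < # A + 2 * j → (∃ λ p → Suspended G A (suc (3 * k)) p) ⊎ # A ≤ suc (3 * k) * (6 * l + 4 * # (Leaf G A) + 2) → Embeds G A
    by-shape _ (inj₁ (p , susp)) = shorten G A p A≤n conn sparse susp smaller
    by-shape tight (inj₂ few) = within (subset-of-size (B x) n high)
      where
      within : (∃ λ W → W ⊆ B x × # W ≡ n) → Embeds G A
      within (W , W⊆ , #W) = Exact.exact x W W⊆ #W G A A≤n (three tight) conn sparse (leaves-bound (# A) (# (Leaf G A)) tight few)
    by-room : Dec (# A + 2 * j ≤ n) → Embeds G A
    by-room (yes fits) = forget (embed-into G l A sparse (B x) j (blue-blue-≤ x) (room fits))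
    by-room (no tight) = by-shape (≰⇒> tight) (Layers.dichotomy G l A conn sparse (≤-trans (n≤1+n 2) (three (≰⇒> tight))) (3 * k))

  embed-low : (∀ y → # (B y) < n) → ∀ (G : Graph n) A → # A ≤ n → Conn G A → Sparse l G A → Smaller A → Embeds G A
  embed-low low G A A≤n conn sparse smaller = by-size (2 ≤? # A)
    where
    by-leaves : # A ≤ suc (3 * k) * (6 * l + 4 * # (Leaf G A) + 2) → Dec (0 < # (Leaf G A)) → Embeds G A
    by-leaves few (no none) = base G A sparse (subst (λ ℓ → # A ≤ suc (3 * k) * (6 * l + 4 * ℓ + 2)) (n≤0⇒n≡0 (≮⇒≥ none)) few)
    by-leaves few (yes some) = remove (#-pos (Leaf G A) some)
      where
      remove : (∃ λ u → u ∈ Leaf G A) → Embeds G A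
      remove (u , u∈) = add-leaf low G A u A≤n u∈
        (smaller G (A - u) (≡-sym (#-remove A u (∧-left u∈))) (conn-remove-leaf G A u conn u∈) (sparse-⊆ {G = G} (λ _ → ∧-left) sparse))
    by-shape : (∃ λ p → Suspended G A (suc (3 * k)) p) ⊎ # A ≤ suc (3 * k) * (6 * l + 4 * # (Leaf G A) + 2) → Embeds G A
    by-shape (inj₁ (p , susp)) = shorten G A p A≤n conn sparse susp smaller
    by-shape (inj₂ few) = by-leaves few (0 <? # (Leaf G A))
    tiny : ¬ 2 ≤ # A → # A ≤ suc (3 * k) * (6 * l + 4 * 0 + 2)
    tiny small = ≤-trans (s≤s⁻¹ (≰⇒> small)) (≤-trans (m≤n+m 1 (6 * l + 4 * 0 + 1))
      (≤-trans (≤-reflexive (+-assoc (6 * l + 4 * 0) 1 1)) (m≤n*m (6 * l + 4 * 0 + 2) (suc (3 * k)))))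
    by-size : Dec (2 ≤ # A) → Embeds G A
    by-size (no small) = base G A sparse (tiny small)
    by-size (yes large) = by-shape (Layers.dichotomy G l A conn sparse large (3 * k))

  embed-step : ∀ (G : Graph n) A → # A ≤ n → Conn G A → Sparse l G A → Smaller A → Embeds G A
  embed-step with any? (λ x → n ≤? # (B x))
  ... | yes (x , high) = embed-high x high
  ... | no none = embed-low λ y → ≰⇒> λ h → none (y , h)

  embeds : ∀ m (G : Graph n) A → # A ≡ m → m ≤ n → Conn G A → Sparse l G A → Embeds G A
  embeds zero G A size m≤n conn sparse = embed-step G A (≤-trans (≤-reflexive size) m≤n) conn sparse
    λ G′ A′ e → case trans e size of λ ()
  embeds (suc m) G A size m≤n conn sparse = embed-step G A (≤-trans (≤-reflexive size) m≤n) conn sparse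
    λ G′ A′ e → embeds m G′ A′ (suc-injective (trans e size)) (≤-trans (n≤1+n m) m≤n)

-- Edge counts, books, and the colouring by two red cliques

connected⇒conn : ∀ {n} (G : Graph n) → Connected G → Conn G full
connected⇒conn G connected S x x∈ _ closed w _ = along (connected x w) x∈
  where
  along : ∀ {u w} → Walk G u w → u ∈ S → w ∈ S
  along here u∈ = u∈
  along (step {u} {v} e walk) u∈ = along walk (closed u v u∈ refl e)

degSum-insert : ∀ {n} (G : Graph n) S u v → u ∈ S → v ∉ S → Adj G u v ≡ true → degSum G S + 2 ≤ degSum G (S ∪ (v ==_))
degSum-insert G S u v u∈ v∉ uv = begin
  degSum G S + 2
    ≡⟨ cong (degSum G S +_) (cong₂ _+_ (#-single u) (#-single v)) ⟨
  degSum G S + (# (u ==_) + # (v ==_))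
    ≡⟨ cong (degSum G S +_) (∑-distrib-+ (λ x → ⟦ u == x ⟧) (λ x → ⟦ v == x ⟧)) ⟨
  degSum G S + sum (λ x → ⟦ u == x ⟧ + ⟦ v == x ⟧)
    ≡⟨ ∑-distrib-+ (λ x → ⟦ S x ⟧ * deg G S x) (λ x → ⟦ u == x ⟧ + ⟦ v == x ⟧) ⟨
  sum (λ x → ⟦ S x ⟧ * deg G S x + (⟦ u == x ⟧ + ⟦ v == x ⟧))
    ≤⟨ sum-mono pointwise ⟩
  degSum G S⁺ ∎
  where
  open ≤-Reasoning
  S⁺ = S ∪ (v ==_)
  mono : ∀ x → S ∩ Adj G x ⊆ S⁺ ∩ Adj G x
  mono x y e = ∧-intro (∨-left {S y} (∧-left e)) (∧-right {S y} e)
  grow : suc (deg G S u) ≤ deg G S⁺ u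
  grow = ≤-trans (s≤s (#-mono (S ∩ Adj G u) ((S⁺ ∩ Adj G u) - v) λ y e →
      ∈-remove (S⁺ ∩ Adj G u) v (mono u y e) λ { refl → true≢false (∧-left e) v∉ }))
    (≤-reflexive (≡-sym (#-remove (S⁺ ∩ Adj G u) v (∧-intro (∨-right {S v} (==-refl v)) uv))))
  new : 1 ≤ deg G S⁺ v
  new = ≤-trans (s≤s z≤n) (≤-reflexive (≡-sym (#-remove (S⁺ ∩ Adj G v) u (∧-intro (∨-left u∈) (adj-sym G u v uv)))))
  pointwise : ∀ x → ⟦ S x ⟧ * deg G S x + (⟦ u == x ⟧ + ⟦ v == x ⟧) ≤ ⟦ S⁺ x ⟧ * deg G S⁺ x
  pointwise x with S x in x∈ | u ≟ x | v ≟ x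
  ... | true | _ | yes refl = ⊥-elim (true≢false x∈ v∉)
  ... | false | yes refl | _ = ⊥-elim (true≢false u∈ x∈)
  ... | true | yes refl | no _ = ≤-trans (≤-reflexive (trans (cong (_+ 1) (+-identityʳ _)) (+-comm _ 1)))
    (≤-trans grow (≤-reflexive (≡-sym (*-identityˡ (deg G S⁺ u)))))
  ... | true | no _ | no _ = ≤-trans (≤-reflexive (+-identityʳ _)) (*-monoʳ-≤ 1 (#-mono (S ∩ Adj G x) (S⁺ ∩ Adj G x) (mono x)))
  ... | false | no _ | yes refl = ≤-trans new (≤-reflexive (≡-sym (*-identityˡ (deg G S⁺ v))))
  ... | false | no _ | no _ = z≤n

boundary-edge : ∀ {n} (G : Graph n) → Conn G full → ∀ S x y → x ∈ S → y ∉ S →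
  ∃ λ u → ∃ λ v → u ∈ S × v ∉ S × Adj G u v ≡ true
boundary-edge G conn S x y x∈ y∉
  with any? (λ u → any? λ v → (S u ≟ᵇ true) ×-dec (S v ≟ᵇ false) ×-dec (Adj G u v ≟ᵇ true))
... | yes found = found
... | no none = ⊥-elim (true≢false (conn S x x∈ (λ _ _ → refl) closed y refl) y∉)
  where
  closed : ∀ u v → u ∈ S → v ∈ full → Adj G u v ≡ true → v ∈ S
  closed u v u∈ _ e with ∈-dec S v
  ... | inj₁ h = h
  ... | inj₂ h = ⊥-elim (none (u , v , u∈ , h , e))

-- By connectivity some edge leaves `S`. Adding its outer end adds one vertex and at least one edge,
-- so the excess of edges over vertices does not decrease on the way to the whole vertex set, where
-- it is at most `l`.
conn⇒sparse : ∀ {n} (G : Graph n) l → Conn G full → degSum G full ≤ 2 * (n + l) → Sparse l G full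
conn⇒sparse {n} G l conn total S _ = by-complement (# (full ∖ S)) S (≡-sym (#-complement S))
  where
  by-complement : ∀ c S → # S + c ≡ n → degSum G S ≤ 2 * (# S + l)
  by-complement zero S e = ≤-trans (sum-mono pointwise) (≤-trans total
    (≤-reflexive (cong (λ t → 2 * (t + l)) (trans (≡-sym e) (+-identityʳ (# S))))))
    where
    pointwise : ∀ x → ⟦ S x ⟧ * deg G S x ≤ ⟦ true ⟧ * deg G full x
    pointwise x = *-mono-≤ (⟦⟧-mono {S x} λ _ → refl) (#-mono (S ∩ Adj G x) (full ∩ Adj G x) λ y e → ∧-right {S y} e)
  by-complement (suc c) S e with 0 <? # S
  -- No edge leaves the empty set, but its degree sum is zero.
  ... | no none = ≤-trans (#-weighted-≤ S (deg G S) n λ x _ → #≤n (S ∩ Adj G x))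
    (≤-trans (*-monoˡ-≤ n (≮⇒≥ none)) z≤n)
  ... | yes some with #-pos S some | #-cancel-< S full
      (≤-trans (s≤s (m≤m+n (# S) c)) (≤-reflexive (trans (≡-sym (+-suc (# S) c)) (trans e (≡-sym (#-full n))))))
  ... | x , x∈ | y , _ , y∉ with boundary-edge G conn S x y x∈ y∉
  ... | u , v , u∈ , v∉ , uv = +-cancelʳ-≤ 2 _ _ (begin
      degSum G S + 2                  ≤⟨ degSum-insert G S u v u∈ v∉ uv ⟩
      degSum G (S ∪ (v ==_))          ≤⟨ by-complement c (S ∪ (v ==_))
                                           (trans (cong (_+ c) (#-insert S v v∉)) (trans (≡-sym (+-suc (# S) c)) e)) ⟩
      2 * (# (S ∪ (v ==_)) + l)       ≡⟨ cong (λ t → 2 * (t + l)) (#-insert S v v∉) ⟩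
      2 * (suc (# S) + l)             ≡⟨ arith (# S) l ⟩
      2 * (# S + l) + 2               ∎)
    where
    open ≤-Reasoning
    arith : ∀ s l → 2 * (suc s + l) ≡ 2 * (s + l) + 2
    arith = solve-∀

sum-allFin : ∀ {n} (f : Fin n → ℕ) → ListAction.sum (List.map f (allFin n)) ≡ sum f
sum-allFin f = trans (cong ListAction.sum (map-tabulate (λ i → i) f)) (sum-tabulate f)
  where
  sum-tabulate : ∀ {n} (f : Fin n → ℕ) → ListAction.sum (tabulate f) ≡ sum f
  sum-tabulate {zero} f = refl
  sum-tabulate {suc n} f = cong (f zero +_) (sum-tabulate (f ∘ suc))

-- Every adjacency is counted by exactly one of `up x y` and `up y x`, and exchanging the order of
-- summation shows that both have the same total.
handshake : ∀ {n} (G : Graph n) → degSum G full ≡ 2 * edgeCount G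
handshake {n} G = begin
  degSum G full
    ≡⟨ sum-cong-≗ (λ x → *-identityˡ (deg G full x)) ⟩
  sum (λ x → sum λ y → ⟦ Adj G x y ⟧)
    ≡⟨ sum-cong-≗ (λ x → trans (sum-cong-≗ λ y → both x y) (∑-distrib-+ (up x) (λ y → up y x))) ⟩
  sum (λ x → sum (up x) + sum λ y → up y x)
    ≡⟨ ∑-distrib-+ (λ x → sum (up x)) (λ x → sum λ y → up y x) ⟩
  sum (λ x → sum (up x)) + sum (λ x → sum λ y → up y x)
    ≡⟨ cong (sum (λ x → sum (up x)) +_) (∑-comm (λ x y → up y x)) ⟩
  sum (λ x → sum (up x)) + sum (λ x → sum (up x))
    ≡⟨ cong (λ t → t + t) count ⟨
  edgeCount G + edgeCount G
    ≡⟨ cong (edgeCount G +_) (+-identityʳ (edgeCount G)) ⟨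
  2 * edgeCount G ∎
  where
  open ≡-Reasoning
  up : Fin n → Fin n → ℕ
  up i j = if (toℕ i <ᵇ toℕ j) ∧ Adj G i j then 1 else 0
  count : edgeCount G ≡ sum λ x → sum (up x)
  count = trans (sum-allFin (λ i → ListAction.sum (List.map (up i) (allFin n)))) (sum-cong-≗ λ i → sum-allFin (up i))
  <ᵇ-true : ∀ {a b} → a < b → (a <ᵇ b) ≡ true
  <ᵇ-true {a} {b} h with a <ᵇ b | <⇒<ᵇ h
  ... | true | _ = refl
  <ᵇ-false : ∀ {a b} → ¬ a < b → (a <ᵇ b) ≡ false
  <ᵇ-false {a} {b} h with a <ᵇ b in eq
  ... | false = refl
  ... | true = ⊥-elim (h (<ᵇ⇒< a b (subst IsTrue (≡-sym eq) _)))
  indicator : ∀ b → ⟦ b ⟧ ≡ (if b then 1 else 0)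
  indicator true = refl
  indicator false = refl
  both : ∀ x y → ⟦ Adj G x y ⟧ ≡ up x y + up y x
  both x y with <-cmp (toℕ x) (toℕ y)
  ... | tri< lt _ ge rewrite <ᵇ-true lt | <ᵇ-false ge = trans (indicator _) (≡-sym (+-identityʳ _))
  ... | tri> ge _ lt rewrite <ᵇ-true lt | <ᵇ-false ge = trans (cong ⟦_⟧ (Graph.sym G x y)) (indicator _)
  ... | tri≈ ge e _ with toℕ-injective e
  ... | refl rewrite <ᵇ-false ge | irrefl G x = refl

module _ {N} (χ : Colouring N) where
  open Colours χ

  blue-book : ∀ k u v → v ∈ B u → k ≤ # (B u ∩ B v) → ContainsMono χ blue (Book k)
  blue-book k u v uv many with enumerate (B u ∩ B v) k many
  ... | page , page∈ , page-injective = f , f-injective , f-blue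
    where
    f : Fin (suc (suc k)) → Fin N
    f zero = u
    f (suc zero) = v
    f (suc (suc i)) = page i
    u-page : ∀ i → page i ∈ B u
    u-page i = ∧-left (page∈ i)
    v-page : ∀ i → page i ∈ B v
    v-page i = ∧-right {B u (page i)} (page∈ i)
    f-injective : Injective _≡_ _≡_ f
    f-injective {zero} {zero} e = refl
    f-injective {zero} {suc zero} e = ⊥-elim (B-≢ u v uv e)
    f-injective {zero} {suc (suc i)} e = ⊥-elim (B-≢ u (page i) (u-page i) e)
    f-injective {suc zero} {zero} e = ⊥-elim (B-≢ u v uv (≡-sym e))
    f-injective {suc zero} {suc zero} e = refl
    f-injective {suc zero} {suc (suc i)} e = ⊥-elim (B-≢ v (page i) (v-page i) e)
    f-injective {suc (suc i)} {zero} e = ⊥-elim (B-≢ u (page i) (u-page i) (≡-sym e))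
    f-injective {suc (suc i)} {suc zero} e = ⊥-elim (B-≢ v (page i) (v-page i) (≡-sym e))
    f-injective {suc (suc i)} {suc (suc j)} e = cong (λ t → Fin.suc (Fin.suc t)) (page-injective i j e)
    f-blue : ∀ i j → bookAdj k i j ≡ true → col χ (f i) (f j) ≡ blue
    f-blue zero (suc zero) _ = B⇒blue u v uv
    f-blue zero (suc (suc j)) _ = B⇒blue u (page j) (u-page j)
    f-blue (suc zero) zero _ = trans (colSym χ v u) (B⇒blue u v uv)
    f-blue (suc zero) (suc (suc j)) _ = B⇒blue v (page j) (v-page j)
    f-blue (suc (suc i)) zero _ = trans (colSym χ (page i) u) (B⇒blue u (page i) (u-page i))
    f-blue (suc (suc i)) (suc zero) _ = trans (colSym χ (page i) v) (B⇒blue v (page i) (v-page i))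

  book-or-none : ∀ k → ContainsMono χ blue (Book k) ⊎ NoBook χ k
  book-or-none k with any? (λ u → any? λ v → (B u v ≟ᵇ true) ×-dec (k ≤? # (B u ∩ B v)))
  ... | yes (u , v , uv , many) = inj₁ (blue-book k u v uv many)
  ... | no none = inj₂ λ u v uv → ≰⇒> λ many → none (u , v , uv , many)

-- The excess `l` is a truncated difference: it is 0 for a tree, and `edgeCount G ≤ n + l` holds in
-- every case.
arrows : ∀ j n (G : Graph n) → Connected G → 34 * (suc j * suc j * suc j) ≤ n →
  (edgeCount G ∸ n) * (119 * (suc j * suc j) + 62 * suc j) ≤ n → ∀ N → suc N ≡ n + n → Arrows N G (Book (suc j))
arrows j n G connected many few-extra N order χ with book-or-none χ (suc j)
... | inj₁ book = inj₂ book
... | inj₂ no-book with Upper.embeds χ j (edgeCount G ∸ n) no-book order few-extra many y₀ n G full (#-full n) ≤-refl conn sparse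
  where
  conn : Conn G full
  conn = connected⇒conn G connected
  sparse : Sparse (edgeCount G ∸ n) G full
  sparse = conn⇒sparse G _ conn (≤-trans (≤-reflexive (handshake G)) (*-monoʳ-≤ 2 (m≤n+m∸n (edgeCount G) n)))
  two≤n : 2 ≤ n
  two≤n = ≤-trans (≤-trans (s≤s (s≤s z≤n)) (m≤m*n 34 (suc j * suc j * suc j))) many
  y₀ : Fin N
  y₀ = fromℕ< {0} (s≤s⁻¹ (≤-trans two≤n (≤-trans (m≤m+n n n) (≤-reflexive (≡-sym order)))))
... | f , e = inj₁ (f , (λ {x} {y} → Colours.injective e x y refl refl) , λ x y a → Colours.R⇒red χ (f x) (f y) (Colours.edges e x y refl refl a))

-- The lower bound

#-below : ∀ M m → # (λ (x : Fin M) → toℕ x <ᵇ m) ≤ m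
#-below zero m = z≤n
#-below (suc M) zero = ≤-reflexive (#-empty M)
#-below (suc M) (suc m) = s≤s (#-below M m)

#-above : ∀ M m d → M ≤ m + d → # (λ (x : Fin M) → not (toℕ x <ᵇ m)) ≤ d
#-above M zero d h = ≤-trans (#≤n _) h
#-above zero (suc m) d h = z≤n
#-above (suc M) (suc m) d (s≤s h) = #-above M m d h

-- Red joins vertices on the same side, so for `M ≤ m + m` the red cliques are too small for a
-- connected graph with `suc m` vertices. Blue is bipartite and has no triangle, whereas a book with
-- at least one page contains one.
module TwoCliques (M m : ℕ) where

  side : Sub M
  side x = toℕ x <ᵇ m

  paint : Bool → Bool → Colour
  paint true true = red
  paint false false = red
  paint _ _ = blue

  paint-sym : ∀ a b → paint a b ≡ paint b a
  paint-sym true true = refl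
  paint-sym true false = refl
  paint-sym false true = refl
  paint-sym false false = refl

  paint-red : ∀ a b → paint a b ≡ red → a ≡ b
  paint-red true true _ = refl
  paint-red false false _ = refl

  no-blue-triangle : ∀ a b c → paint a b ≡ blue → paint a c ≡ blue → paint b c ≡ blue → ⊥
  no-blue-triangle true false false _ _ ()
  no-blue-triangle false true true _ _ ()

  χ : Colouring M
  χ = record { col = λ x y → paint (side x) (side y) ; colSym = λ x y → paint-sym (side x) (side y) }

  no-blue-book : ∀ j → ¬ ContainsMono χ blue (Book (suc j))
  no-blue-book j (f , _ , blues) = no-blue-triangle (side (f zero)) (side (f (suc zero))) (side (f (suc (suc zero))))
    (blues zero (suc zero) refl) (blues zero (suc (suc zero)) refl) (blues (suc zero) (suc (suc zero)) refl)

  no-red-copy : M ≤ m + m → (G : Graph (suc m)) → Connected G → ¬ ContainsMono χ red G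
  no-red-copy M≤ G connected (f , f-injective , reds) = <-irrefl refl (≤-trans (≤-reflexive (≡-sym (#-full (suc m)))) (by-side (side (f zero)) refl))
    where
    constant : ∀ {u v} → Walk G u v → side (f u) ≡ side (f v)
    constant here = refl
    constant (step {u} {v} e walk) = trans (paint-red _ _ (reds u v e)) (constant walk)
    by-side : ∀ b → side (f zero) ≡ b → # (full {suc m}) ≤ m
    by-side true e = ≤-trans (#-injective-≤ full side f (λ x _ → trans (constant (connected x zero)) e) λ _ _ _ _ → f-injective)
      (#-below M m)
    by-side false e = ≤-trans (#-injective-≤ full (λ x → not (side x)) f
        (λ x _ → not-intro (trans (constant (connected x zero)) e)) λ _ _ _ _ → f-injective)
      (#-above M m m M≤)

theorem1p8 : (k n : ℕ) → 1 ≤ k → 34 * k ^ 3 ≤ n →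
    (G : Graph n) → Connected G →
    edgeCount G * (119 * k ^ 2 + 62 * k) ≤ n * (119 * k ^ 2 + 62 * k) + n →
    RamseyNumberIs G (Book k) (2 * n ∸ 1)
theorem1p8 (suc j) zero _ many _ _ _ = ⊥-elim (<⇒≱ (≤-trans (s≤s z≤n) (m≤m*n 34 (suc j ^ 3) {{m^n≢0 (suc j) 3}})) many)
theorem1p8 (suc j) (suc m) _ many G connected edges =
  ≤-trans (s≤s z≤n) (m≤n+m _ m) , arrows j (suc m) G connected many′ few (2 * suc m ∸ 1) order , lower
  where
  cube : ∀ k → k ^ 3 ≡ k * k * k
  cube k = trans (cong (λ t → k * (k * t)) (*-identityʳ k)) (≡-sym (*-assoc k k k))
  square : ∀ k → k ^ 2 ≡ k * k
  square k = cong (k *_) (*-identityʳ k)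
  many′ : 34 * (suc j * suc j * suc j) ≤ suc m
  many′ = subst (λ t → 34 * t ≤ suc m) (cube (suc j)) many
  -- Subtracting `n * K` from both sides of the edge hypothesis bounds the excess times `K` by `n`.
  few : (edgeCount G ∸ suc m) * (119 * (suc j * suc j) + 62 * suc j) ≤ suc m
  few = ≤-trans (≤-reflexive (*-distribʳ-∸ K (edgeCount G) (suc m)))
    (m≤n+o⇒m∸n≤o (edgeCount G * K) (suc m * K) (subst (λ t → edgeCount G * (119 * t + 62 * suc j) ≤ suc m * (119 * t + 62 * suc j) + suc m) (square (suc j)) edges))
    where
    K = 119 * (suc j * suc j) + 62 * suc j
  order : suc (2 * suc m ∸ 1) ≡ suc m + suc m
  order = cong (λ t → suc (m + suc t)) (+-identityʳ m)
  lower : ∀ M → 1 ≤ M → M < 2 * suc m ∸ 1 → ¬ Arrows M G (Book (suc j))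
  lower M _ M< arrow with arrow (TwoCliques.χ M m)
  ... | inj₁ copy = TwoCliques.no-red-copy M m
      (s≤s⁻¹ (≤-trans M< (≤-reflexive (trans (cong (λ t → m + suc t) (+-identityʳ m)) (+-suc m m))))) G connected copy
  ... | inj₂ book = TwoCliques.no-blue-book M m j book
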